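{- Let $r$ be a prime and $q$ a prime power with $q \equiv 1 \pmod r$. Let $f(x)\in \mathbb{F}_q[x]$ be a unicritical polynomial of degree $r$ with critical point $\gamma$ and leading coefficient $a$. Then $f$ is dynamically irreducible over $\mathbb{F}_q$ if and only if the set $$\left\lbrace -\frac{f(\gamma)}{a}\right\rbrace \cup \left\lbrace \frac{f^n(\gamma)}{a}: n\in \mathbb{Z},\ n>1\right\rbrace$$ contains no $r$-th powers in $\mathbb{F}_q$ (that is, no element of the form $y^r$ with $y\in\mathbb{F}_q$).
   Context: $\mathbb{F}_q$ denotes the finite field with $q$ elements. For a polynomial $f$, $f^n$ denotes the $n$-fold composition $f\circ f\circ\cdots\circ f$. A polynomial $f\in K[x]$ of degree at least $2$ over a field $K$ is dynamically irreducible over $K$ if $f^n$ is irreducible over $K$ for all positive integers $n$. A polynomial is unicritical if it has a single affine critical point $\gamma$; here this is taken to mean that $f(x)=a(x-\gamma)^r+e$ for some $a,\gamma,e\in\mathbb{F}_q$ with $a\neq 0$, where $r=\deg f$; equivalently $f(x+\gamma)-\gamma=ax^r+c$ with $c=e-\gamma$. -}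

module Defs where

open import Algebra.Bundles using (CommutativeRing; RawSemiring; Semiring)
import Algebra.Definitions
import Algebra.Definitions.RawSemiring
open import Data.Fin.Base using (Fin)
open import Data.Integer.Base using (+_) renaming (_-_ to _-ℤ_)
import Data.Integer.Divisibility as ℤ
open import Data.List.Base using (List; []; _∷_; map)
open import Data.Nat.Base as ℕ using (ℕ; zero; suc)
open import Data.Nat.Primality using (Prime)
open import Data.Product.Base using (Σ-syntax; ∃-syntax; _×_; proj₁)
open import Function.Bundles using (Inverse)
open import Level using (_⊔_) renaming (suc to lsuc)
open import Relation.Binary.PropositionalEquality.Core using (_≡_)
open import Relation.Binary.PropositionalEquality.Properties as ≡ using ()
open import Relation.Nullary.Negation.Core using (¬_)
open import Relation.Unary using (Pred; _∪_)

PrimePower : ℕ → Set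
PrimePower q = ∃[ p ] ∃[ k ] Prime p × 1 ℕ.≤ k × q ≡ p ℕ.^ k

_≡_[mod_] : ℕ → ℕ → ℕ → Set
a ≡ b [mod m ] = (+ m) ℤ.∣ (+ a -ℤ + b)

-- Coefficient lists, constant term first.  Trailing zeros are allowed;
-- _≈ₚ_ identifies lists that differ only in these.
module Polynomial {c ℓ} (R : CommutativeRing c ℓ) where
  open CommutativeRing R

  Poly : Set c
  Poly = List Carrier

  coeff : Poly → ℕ → Carrier
  coeff []      _       = 0#
  coeff (a ∷ _) zero    = a
  coeff (_ ∷ f) (suc n) = coeff f n

  infix 4 _≈ₚ_
  _≈ₚ_ : Poly → Poly → Set ℓ
  f ≈ₚ g = ∀ n → coeff f n ≈ coeff g n

  const : Carrier → Poly
  const a = a ∷ []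

  X : Poly
  X = 0# ∷ 1# ∷ []

  infixl 6 _+ₚ_
  _+ₚ_ : Poly → Poly → Poly
  []      +ₚ g       = g
  (a ∷ f) +ₚ []      = a ∷ f
  (a ∷ f) +ₚ (b ∷ g) = (a + b) ∷ (f +ₚ g)

  infixl 7 _*ₚ_
  _*ₚ_ : Poly → Poly → Poly
  []      *ₚ g = []
  (a ∷ f) *ₚ g = map (a *_) g +ₚ (0# ∷ (f *ₚ g))

  polyRawSemiring : RawSemiring c ℓ
  polyRawSemiring = record
    { Carrier = Poly
    ; _≈_     = _≈ₚ_
    ; _+_     = _+ₚ_
    ; _*_     = _*ₚ_
    ; 0#      = []
    ; 1#      = const 1#
    }

  open Algebra.Definitions.RawSemiring polyRawSemiring public
    using (Irreducible) renaming (_^_ to _^ₚ_)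

  HasDegree : Poly → ℕ → Set ℓ
  HasDegree f d = (¬ coeff f d ≈ 0#) × (∀ m → d ℕ.< m → coeff f m ≈ 0#)

  eval : Poly → Carrier → Carrier
  eval []      x = 0#
  eval (a ∷ f) x = a + x * eval f x

  infixr 9 _∘ₚ_
  _∘ₚ_ : Poly → Poly → Poly
  []      ∘ₚ g = []
  (a ∷ f) ∘ₚ g = const a +ₚ g *ₚ (f ∘ₚ g)

  iterate : Poly → ℕ → Poly
  iterate f zero    = X
  iterate f (suc n) = f ∘ₚ iterate f n

  DynamicallyIrreducible : Poly → Set (c ⊔ ℓ)
  DynamicallyIrreducible f =
    (∃[ d ] 2 ℕ.≤ d × HasDegree f d) × (∀ n → 1 ℕ.≤ n → Irreducible (iterate f n))

  -- The form itself forces a to be the leading coefficient.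
  record Unicritical (f : Poly) (r : ℕ) (γ a : Carrier) : Set (c ⊔ ℓ) where
    field
      degree : HasDegree f r
      a≉0    : ¬ a ≈ 0#
      form   : Σ[ e ∈ Carrier ] f ≈ₚ const a *ₚ (X +ₚ const (- γ)) ^ₚ r +ₚ const e

record FiniteField (q : ℕ) c ℓ : Set (lsuc (c ⊔ ℓ)) where
  field
    commutativeRing : CommutativeRing c ℓ

  open CommutativeRing commutativeRing public
  open Algebra.Definitions _≈_ using (Invertible)

  field
    1≉0         : ¬ 1# ≈ 0#
    invertible  : ∀ x → ¬ x ≈ 0# → Invertible 1# _*_ x
    enumeration : Inverse setoid (≡.setoid (Fin q))

  divide : Carrier → (a : Carrier) → ¬ a ≈ 0# → Carrier
  divide x a a≉0 = x * proj₁ (invertible a a≉0)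

  open Polynomial commutativeRing public
  open Algebra.Definitions.RawSemiring (Semiring.rawSemiring semiring) using (_^_)

  IsPower : ℕ → Pred Carrier (c ⊔ ℓ)
  IsPower r z = ∃[ y ] z ≈ y ^ r

  CriticalOrbitSet : Poly → Carrier → (a : Carrier) → ¬ a ≈ 0# → Pred Carrier ℓ
  CriticalOrbitSet f γ a a≉0 =
    (λ z → z ≈ divide (- eval f γ) a a≉0) ∪
    (λ z → ∃[ n ] 1 ℕ.< n × z ≈ divide (eval (iterate f n) γ) a a≉0)

{-# OPTIONS --safe #-}

-- Let g be the n-th iterate, irreducible of degree d with leading coefficient l, and write
-- f = a (X - γ) ^ r + e.  An irreducible factor p of g ∘ f gives a field M = K[X] / (p) in which the
-- class of f is a root z of g and e - z = - a w ^ r, with w = X - γ.  The Frobenius φ of M has period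
-- exactly d on z, and the conjugates of z are the roots of g, so taking the product of the
-- conjugates φ ^ i (e - z) for i < d gives g(e) = l (- a) ^ d b with b = N ^ r, where N is the product
-- of the φ ^ i w.  Telescoping, φ ^ d w = N ^ (q - 1) w = ζ w with ζ = b ^ ((q - 1) / r).  If b is an
-- r-th power then φ ^ d fixes X, so p has degree at most d.  Otherwise ζ is a primitive r-th root of
-- unity, the period of X is a multiple of d r, and so g ∘ f has no proper factor.  Up to r-th
-- powers, b is the element of the critical orbit set attached to the (n + 1)-st iterate.

module Submission where

import Algebra.Definitions.RawMagma
import Algebra.Definitions.RawSemiring
import Algebra.Morphism.Construct.Composition as Composition
import Algebra.Properties.CommutativeMonoid.Sum as Sum
import Algebra.Properties.CommutativeSemiring.Exp as Exp
import Algebra.Properties.Ring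
import Algebra.Properties.Semiring.Divisibility as Divisibility
import Algebra.Properties.Semiring.Mult.TCOptimised
import Algebra.Properties.Semiring.Primality as Primality
import Algebra.Solver.Ring
import Data.Fin.Properties as Fin
import Data.Integer.Properties as ℤ
import Data.Nat.Properties as ℕ
open import Algebra.Bundles using (CommutativeRing)
open import Algebra.Morphism.Structures using (module RingMorphisms)
open import Algebra.Solver.Ring.AlmostCommutativeRing using (fromCommutativeRing; _-Raw-AlmostCommutative⟶_)
open import Algebra.Structures using (IsCommutativeRing)
open import Data.Fin.Base as Fin using (Fin; zero; suc; toℕ; punchIn)
open import Data.Fin.Permutation using (Permutation; permutation; _⟨$⟩ʳ_)
open import Data.Integer.Base as ℤ using (ℤ; +_; -[1+_]; +-*-rawRing)
open import Data.List.Base using ([]; _∷_; map)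
open import Data.Maybe.Base using (Maybe; just; nothing)
open import Data.Nat.Base as ℕ using (ℕ; zero; suc; z≤n; s≤s)
open import Data.Nat.Coprimality using (coprime-Bézout; prime⇒coprime)
open import Data.Nat.DivMod using (_/_; _%_; m≡m%n+[m/n]*n; m%n<n)
open import Data.Nat.Divisibility as ℕ using (divides)
open import Data.Nat.GCD using (module Bézout)
open import Data.Nat.Primality using (Prime; prime⇒nonZero; prime⇒nonTrivial)
open import Data.Product.Base using (_,_; ∃-syntax; _×_; proj₁; proj₂)
open import Data.Sum.Base as ⊎ using (_⊎_; inj₁; inj₂)
open import Defs
open import Function.Base using (_∘_; id)
open import Function.Bundles using (_⇔_; mk⇔; Equivalence; Inverse)
open import Level using (_⊔_) renaming (suc to lsuc)
open import Relation.Binary.Definitions using (Decidable; tri<; tri≈; tri>)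
open import Relation.Binary.PropositionalEquality.Core as ≡ using (_≡_)
open import Relation.Nullary.Decidable.Core using (Dec; yes; no; _×-dec_; ¬?; map′)
open import Relation.Nullary.Negation.Core using (¬_; contradiction)
open import Relation.Unary using (_∈_)

-- The sign and the range n > 1 in the orbit set both come from the factor l (- a) ^ d. For g = X
-- this factor is - a, so b = e / (- a) is the element - f(γ) / a itself. If g is the i-th iterate
-- with i at least 1, then d = r ^ i is a multiple of r, so (- a) ^ d is an r-th power and the sign
-- disappears, while l is a times an r-th power. As e = f(γ), the value g(e) is the (i + 1)-st
-- iterate at γ, and b agrees with that value over a up to an r-th power. Four facts rest on one
-- principle, `roots-bound`, that a polynomial of degree below n with n distinct roots is zero: the
-- additivity of φ, the equality of its fixed points with K, the period d of a root of g, and the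
-- criterion c ^ ((q - 1) / r) = 1 for r-th powers. The element w is singled out because φ ^ d acts
-- on it by a scalar ζ of K. Since φ fixes ζ, iterating multiplies scalars, and the period of w is
-- read off from the order of ζ.

-- A ring solver with integer coefficients over any commutative ring.

module IntegerSolver {c ℓ} (R : CommutativeRing c ℓ) where
  open CommutativeRing R
  open Algebra.Properties.Ring ring
  open Algebra.Properties.Semiring.Mult.TCOptimised semiring using (×-homo-+) renaming (_×_ to _·_)
  open import Relation.Binary.Reasoning.Setoid setoid

  private
    -- This variant of the multiple makes `nat 1` reduce to `1#` without a trailing `0#`, so
    -- `con (+ 1)` in the solver matches `1#` by `refl`.
    nat : ℕ → Carrier
    nat n = n · 1#

    int : ℤ → Carrier
    int (+ n)    = nat n
    int -[1+ n ] = - nat (suc n)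

    nat-suc : ∀ n → nat (suc n) ≈ 1# + nat n
    nat-suc = ×-homo-+ 1# 1

    int-⊖ : ∀ m n → int (m ℤ.⊖ n) ≈ nat m - nat n
    int-⊖ m zero = sym (trans (+-congˡ -0#≈0#) (+-identityʳ _))
    int-⊖ zero (suc n) = sym (+-identityˡ _)
    int-⊖ (suc m) (suc n) = begin
      int (suc m ℤ.⊖ suc n)                  ≡⟨ ≡.cong int (ℤ.[1+m]⊖[1+n]≡m⊖n m n) ⟩
      int (m ℤ.⊖ n)                          ≈⟨ int-⊖ m n ⟩
      nat m - nat n                          ≈⟨ +-congʳ (+-identityʳ _) ⟨
      nat m + 0# - nat n                     ≈⟨ +-congʳ (+-congˡ (-‿inverseʳ 1#)) ⟨
      nat m + (1# - 1#) - nat n              ≈⟨ +-congʳ (+-assoc _ _ _) ⟨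
      nat m + 1# - 1# - nat n                ≈⟨ +-congʳ (+-congʳ (+-comm _ _)) ⟩
      1# + nat m - 1# - nat n                ≈⟨ +-assoc _ _ _ ⟩
      1# + nat m + (- 1# - nat n)
          ≈⟨ +-cong (nat-suc m) (trans (-‿cong (nat-suc n)) (sym (-‿+-comm 1# (nat n)))) ⟨
      nat (suc m) - nat (suc n)              ∎

    int-+ : ∀ i j → int (i ℤ.+ j) ≈ int i + int j
    int-+ (+ m)    (+ n)    = ×-homo-+ 1# m n
    int-+ (+ m)    -[1+ n ] = int-⊖ m (suc n)
    int-+ -[1+ m ] (+ n)    = trans (int-⊖ n (suc m)) (+-comm _ _)
    int-+ -[1+ m ] -[1+ n ] = begin
      - nat (suc (suc (m ℕ.+ n)))   ≡⟨ ≡.cong (λ k → - nat (suc k)) (ℕ.+-suc m n) ⟨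
      - nat (suc m ℕ.+ suc n)       ≈⟨ -‿cong (×-homo-+ 1# (suc m) (suc n)) ⟩
      - (nat (suc m) + nat (suc n)) ≈⟨ -‿+-comm _ _ ⟨
      - nat (suc m) - nat (suc n)   ∎

    int-neg : ∀ i → int (ℤ.- i) ≈ - int i
    int-neg (+ zero)  = sym -0#≈0#
    int-neg (+ suc n) = refl
    int-neg -[1+ n ]  = sym (-‿involutive _)

    int-pos-* : ∀ m j → int (+ m ℤ.* j) ≈ nat m * int j
    int-pos-* zero j = sym (zeroˡ _)
    int-pos-* (suc m) j = begin
      int (+ suc m ℤ.* j)          ≡⟨ ≡.cong int (ℤ.suc-* (+ m) j) ⟩
      int (j ℤ.+ + m ℤ.* j)        ≈⟨ int-+ j (+ m ℤ.* j) ⟩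
      int j + int (+ m ℤ.* j)      ≈⟨ +-cong (sym (*-identityˡ _)) (int-pos-* m j) ⟩
      1# * int j + nat m * int j   ≈⟨ distribʳ _ _ _ ⟨
      (1# + nat m) * int j         ≈⟨ *-congʳ (nat-suc m) ⟨
      nat (suc m) * int j          ∎

    int-* : ∀ i j → int (i ℤ.* j) ≈ int i * int j
    int-* (+ m) j = int-pos-* m j
    int-* -[1+ m ] j = begin
      int (-[1+ m ] ℤ.* j)          ≡⟨ ≡.cong int (ℤ.neg-distribˡ-* (+ suc m) j) ⟨
      int (ℤ.- (+ suc m ℤ.* j))     ≈⟨ int-neg (+ suc m ℤ.* j) ⟩
      - int (+ suc m ℤ.* j)         ≈⟨ -‿cong (int-pos-* (suc m) j) ⟩
      - (nat (suc m) * int j)       ≈⟨ -‿distribˡ-* _ _ ⟩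
      - nat (suc m) * int j         ∎

    morphism : +-*-rawRing -Raw-AlmostCommutative⟶ fromCommutativeRing R
    morphism = record
      { ⟦_⟧ = int ; +-homo = int-+ ; *-homo = int-* ; -‿homo = int-neg
      ; 0-homo = refl ; 1-homo = refl }

    _≟_ : ∀ i j → Maybe (int i ≈ int j)
    i ≟ j with i ℤ.≟ j
    ... | yes i≡j = just (reflexive (≡.cong int i≡j))
    ... | no  _   = nothing

  open Algebra.Solver.Ring +-*-rawRing (fromCommutativeRing R) morphism _≟_ public
    using (solve; _:=_; _:+_; _:*_; _:-_; :-_; con)

-- Coefficient lists form a commutative ring.

module PolynomialLaws {c ℓ} (R : CommutativeRing c ℓ) where
  open CommutativeRing R
  open Algebra.Properties.Ring ring
  open Polynomial R
  open IntegerSolver R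
  open import Relation.Binary.Reasoning.Setoid setoid

  infix 8 -ₚ_
  -ₚ_ : Poly → Poly
  -ₚ f = map (-_) f

  shift : Poly → Poly
  shift f = 0# ∷ f

  scale : Carrier → Poly → Poly
  scale a = map (a *_)

  coeff-+ : ∀ f g n → coeff (f +ₚ g) n ≈ coeff f n + coeff g n
  coeff-+ []      g       n       = sym (+-identityˡ _)
  coeff-+ (a ∷ f) []      n       = sym (+-identityʳ _)
  coeff-+ (a ∷ f) (b ∷ g) zero    = refl
  coeff-+ (a ∷ f) (b ∷ g) (suc n) = coeff-+ f g n

  coeff-scale : ∀ a f n → coeff (scale a f) n ≈ a * coeff f n
  coeff-scale a []      n       = sym (zeroʳ a)
  coeff-scale a (b ∷ f) zero    = refl
  coeff-scale a (b ∷ f) (suc n) = coeff-scale a f n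

  coeff-neg : ∀ f n → coeff (-ₚ f) n ≈ - coeff f n
  coeff-neg []      n       = sym -0#≈0#
  coeff-neg (a ∷ f) zero    = refl
  coeff-neg (a ∷ f) (suc n) = coeff-neg f n

  shift-cong : ∀ {f g} → f ≈ₚ g → shift f ≈ₚ shift g
  shift-cong p zero    = refl
  shift-cong p (suc n) = p n

  shift-+ : ∀ f g n → coeff (shift (f +ₚ g)) n ≈ coeff (shift f) n + coeff (shift g) n
  shift-+ f g zero    = sym (+-identityˡ 0#)
  shift-+ f g (suc n) = coeff-+ f g n

  shift-scale : ∀ a f n → coeff (shift (scale a f)) n ≈ a * coeff (shift f) n
  shift-scale a f zero    = sym (zeroʳ a)
  shift-scale a f (suc n) = coeff-scale a f n

  coeff-∷* : ∀ a f g n → coeff ((a ∷ f) *ₚ g) n ≈ a * coeff g n + coeff (shift (f *ₚ g)) n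
  coeff-∷* a f g n = trans (coeff-+ (scale a g) (shift (f *ₚ g)) n) (+-congʳ (coeff-scale a g n))

  +ₚ-cong : ∀ f f′ g g′ → f ≈ₚ f′ → g ≈ₚ g′ → f +ₚ g ≈ₚ f′ +ₚ g′
  +ₚ-cong f f′ g g′ p q n =
    trans (coeff-+ f g n) (trans (+-cong (p n) (q n)) (sym (coeff-+ f′ g′ n)))

  +ₚ-assoc : ∀ f g h → (f +ₚ g) +ₚ h ≈ₚ f +ₚ (g +ₚ h)
  +ₚ-assoc f g h n = begin
    coeff ((f +ₚ g) +ₚ h) n               ≈⟨ trans (coeff-+ (f +ₚ g) h n) (+-congʳ (coeff-+ f g n)) ⟩
    coeff f n + coeff g n + coeff h n     ≈⟨ +-assoc _ _ _ ⟩
    coeff f n + (coeff g n + coeff h n)   ≈⟨ trans (coeff-+ f (g +ₚ h) n) (+-congˡ (coeff-+ g h n)) ⟨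
    coeff (f +ₚ (g +ₚ h)) n               ∎

  +ₚ-comm : ∀ f g → f +ₚ g ≈ₚ g +ₚ f
  +ₚ-comm f g n = trans (coeff-+ f g n) (trans (+-comm _ _) (sym (coeff-+ g f n)))

  +ₚ-identityʳ : ∀ f → f +ₚ [] ≈ₚ f
  +ₚ-identityʳ f n = trans (coeff-+ f [] n) (+-identityʳ _)

  -ₚ-cong : ∀ {f g} → f ≈ₚ g → -ₚ f ≈ₚ -ₚ g
  -ₚ-cong {f} {g} p n = trans (coeff-neg f n) (trans (-‿cong (p n)) (sym (coeff-neg g n)))

  -ₚ-inverseʳ : ∀ f → f +ₚ -ₚ f ≈ₚ []
  -ₚ-inverseʳ f n = trans (coeff-+ f (-ₚ f) n) (trans (+-congˡ (coeff-neg f n)) (-‿inverseʳ _))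

  *ₚ-congˡ : ∀ f {g g′} → g ≈ₚ g′ → f *ₚ g ≈ₚ f *ₚ g′
  *ₚ-congˡ []      p n = refl
  *ₚ-congˡ (a ∷ f) {g} {g′} p n = begin
    coeff ((a ∷ f) *ₚ g) n                        ≈⟨ coeff-∷* a f g n ⟩
    a * coeff g n + coeff (shift (f *ₚ g)) n      ≈⟨ +-cong (*-congˡ (p n)) (shift-cong (*ₚ-congˡ f p) n) ⟩
    a * coeff g′ n + coeff (shift (f *ₚ g′)) n    ≈⟨ coeff-∷* a f g′ n ⟨
    coeff ((a ∷ f) *ₚ g′) n                       ∎

  shift-[] : ∀ {f} → f ≈ₚ [] → shift f ≈ₚ []
  shift-[] p zero    = refl
  shift-[] p (suc n) = p n

  *ₚ-zeroʳ : ∀ f → f *ₚ [] ≈ₚ []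
  *ₚ-zeroʳ []      n = refl
  *ₚ-zeroʳ (a ∷ f) n = shift-[] (*ₚ-zeroʳ f) n

  -- Mirror image of `coeff-∷*`. Expanding along the second factor is what lets `*ₚ-comm` go by
  -- induction on that factor.
  coeff-*∷ : ∀ f b g n → coeff (f *ₚ (b ∷ g)) n ≈ coeff f n * b + coeff (shift (f *ₚ g)) n
  coeff-*∷ [] b g zero    = sym (trans (+-congʳ (zeroˡ b)) (+-identityˡ 0#))
  coeff-*∷ [] b g (suc n) = sym (trans (+-congʳ (zeroˡ b)) (+-identityˡ 0#))
  coeff-*∷ (a ∷ f) b g zero    = refl
  coeff-*∷ (a ∷ f) b g (suc n) = begin
    coeff (scale a g +ₚ f *ₚ (b ∷ g)) n                               ≈⟨ coeff-+ (scale a g) _ n ⟩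
    coeff (scale a g) n + coeff (f *ₚ (b ∷ g)) n
        ≈⟨ +-cong (coeff-scale a g n) (coeff-*∷ f b g n) ⟩
    a * coeff g n + (coeff f n * b + coeff (shift (f *ₚ g)) n)
        ≈⟨ solve 3 (λ x y z → x :+ (y :+ z) := y :+ (x :+ z)) refl _ _ _ ⟩
    coeff f n * b + (a * coeff g n + coeff (shift (f *ₚ g)) n)        ≈⟨ +-congˡ (coeff-∷* a f g n) ⟨
    coeff f n * b + coeff ((a ∷ f) *ₚ g) n                            ∎

  *ₚ-comm : ∀ f g → f *ₚ g ≈ₚ g *ₚ f
  *ₚ-comm f []      n = *ₚ-zeroʳ f n
  *ₚ-comm f (b ∷ g) n = begin
    coeff (f *ₚ (b ∷ g)) n                      ≈⟨ coeff-*∷ f b g n ⟩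
    coeff f n * b + coeff (shift (f *ₚ g)) n    ≈⟨ +-cong (*-comm _ _) (shift-cong (*ₚ-comm f g) n) ⟩
    b * coeff f n + coeff (shift (g *ₚ f)) n    ≈⟨ coeff-∷* b g f n ⟨
    coeff ((b ∷ g) *ₚ f) n                      ∎

  *ₚ-congʳ : ∀ f f′ g → f ≈ₚ f′ → f *ₚ g ≈ₚ f′ *ₚ g
  *ₚ-congʳ f f′ g p n = trans (*ₚ-comm f g n) (trans (*ₚ-congˡ g p n) (*ₚ-comm g f′ n))

  *ₚ-cong : ∀ f f′ g g′ → f ≈ₚ f′ → g ≈ₚ g′ → f *ₚ g ≈ₚ f′ *ₚ g′
  *ₚ-cong f f′ g g′ p q n = trans (*ₚ-congʳ f f′ g p n) (*ₚ-congˡ f′ q n)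

  *ₚ-distribˡ : ∀ f g h → f *ₚ (g +ₚ h) ≈ₚ f *ₚ g +ₚ f *ₚ h
  *ₚ-distribˡ []      g h n = refl
  *ₚ-distribˡ (a ∷ f) g h n = begin
    coeff ((a ∷ f) *ₚ (g +ₚ h)) n
      ≈⟨ coeff-∷* a f (g +ₚ h) n ⟩
    a * coeff (g +ₚ h) n + coeff (shift (f *ₚ (g +ₚ h))) n
      ≈⟨ +-cong (*-congˡ (coeff-+ g h n))
                (trans (shift-cong (*ₚ-distribˡ f g h) n) (shift-+ (f *ₚ g) (f *ₚ h) n)) ⟩
    a * (coeff g n + coeff h n) + (coeff (shift (f *ₚ g)) n + coeff (shift (f *ₚ h)) n)
      ≈⟨ solve 5 (λ a x y u v → a :* (x :+ y) :+ (u :+ v) := (a :* x :+ u) :+ (a :* y :+ v)) refl _ _ _ _ _ ⟩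
    (a * coeff g n + coeff (shift (f *ₚ g)) n) + (a * coeff h n + coeff (shift (f *ₚ h)) n)
      ≈⟨ +-cong (coeff-∷* a f g n) (coeff-∷* a f h n) ⟨
    coeff ((a ∷ f) *ₚ g) n + coeff ((a ∷ f) *ₚ h) n
      ≈⟨ coeff-+ ((a ∷ f) *ₚ g) ((a ∷ f) *ₚ h) n ⟨
    coeff ((a ∷ f) *ₚ g +ₚ (a ∷ f) *ₚ h) n ∎

  *ₚ-distribʳ : ∀ f g h → (g +ₚ h) *ₚ f ≈ₚ g *ₚ f +ₚ h *ₚ f
  *ₚ-distribʳ f g h n = begin
    coeff ((g +ₚ h) *ₚ f) n         ≈⟨ *ₚ-comm (g +ₚ h) f n ⟩
    coeff (f *ₚ (g +ₚ h)) n         ≈⟨ *ₚ-distribˡ f g h n ⟩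
    coeff (f *ₚ g +ₚ f *ₚ h) n      ≈⟨ +ₚ-cong (f *ₚ g) (g *ₚ f) (f *ₚ h) (h *ₚ f) (*ₚ-comm f g) (*ₚ-comm f h) n ⟩
    coeff (g *ₚ f +ₚ h *ₚ f) n      ∎

  scale-* : ∀ a g h → scale a g *ₚ h ≈ₚ scale a (g *ₚ h)
  scale-* a []      h n = refl
  scale-* a (b ∷ g) h n = begin
    coeff (scale a (b ∷ g) *ₚ h) n
      ≈⟨ coeff-∷* (a * b) (scale a g) h n ⟩
    a * b * coeff h n + coeff (shift (scale a g *ₚ h)) n
      ≈⟨ +-cong (*-assoc _ _ _) (trans (shift-cong (scale-* a g h) n) (shift-scale a (g *ₚ h) n)) ⟩
    a * (b * coeff h n) + a * coeff (shift (g *ₚ h)) n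
      ≈⟨ distribˡ _ _ _ ⟨
    a * (b * coeff h n + coeff (shift (g *ₚ h)) n)
      ≈⟨ *-congˡ (coeff-∷* b g h n) ⟨
    a * coeff ((b ∷ g) *ₚ h) n
      ≈⟨ coeff-scale a ((b ∷ g) *ₚ h) n ⟨
    coeff (scale a ((b ∷ g) *ₚ h)) n ∎

  shift-* : ∀ f g → shift f *ₚ g ≈ₚ shift (f *ₚ g)
  shift-* f g n = trans (coeff-∷* 0# f g n) (trans (+-congʳ (zeroˡ _)) (+-identityˡ _))

  *ₚ-assoc : ∀ f g h → (f *ₚ g) *ₚ h ≈ₚ f *ₚ (g *ₚ h)
  *ₚ-assoc []      g h n = refl
  *ₚ-assoc (a ∷ f) g h n = begin
    coeff ((scale a g +ₚ shift (f *ₚ g)) *ₚ h) n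
      ≈⟨ *ₚ-distribʳ h (scale a g) (shift (f *ₚ g)) n ⟩
    coeff (scale a g *ₚ h +ₚ shift (f *ₚ g) *ₚ h) n
      ≈⟨ +ₚ-cong (scale a g *ₚ h) (scale a (g *ₚ h)) (shift (f *ₚ g) *ₚ h) (shift (f *ₚ (g *ₚ h)))
           (scale-* a g h)
           (λ k → trans (shift-* (f *ₚ g) h k) (shift-cong (*ₚ-assoc f g h) k)) n ⟩
    coeff ((a ∷ f) *ₚ (g *ₚ h)) n ∎

  *ₚ-identityˡ : ∀ f → const 1# *ₚ f ≈ₚ f
  *ₚ-identityˡ f n = begin
    coeff (const 1# *ₚ f) n              ≈⟨ coeff-∷* 1# [] f n ⟩
    1# * coeff f n + coeff (shift []) n  ≈⟨ +-cong (*-identityˡ _) (shift-[] (λ _ → refl) n) ⟩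
    coeff f n + 0#                       ≈⟨ +-identityʳ _ ⟩
    coeff f n                            ∎

module PolynomialRing {c ℓ} (R : CommutativeRing c ℓ) where
  open CommutativeRing R
  open Polynomial R public using (Poly; coeff; const; X)
  open Polynomial R using (_≈ₚ_; _+ₚ_; _*ₚ_)
  open PolynomialLaws R

  infix 4 _≋_
  infixl 6 _⊕_
  infixl 7 _⊗_

  -- A record and opaque operations let Agda infer polynomials from an equation between them, which
  -- the computing definitions _≈ₚ_, _+ₚ_ and _*ₚ_ do not.
  record _≋_ (f g : Poly) : Set ℓ where
    constructor coeffwise
    field coeff-≈ : f ≈ₚ g
  open _≋_ public

  opaque
    _⊕_ : Poly → Poly → Poly
    _⊕_ = _+ₚ_

    _⊗_ : Poly → Poly → Poly
    _⊗_ = _*ₚ_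

    neg : Poly → Poly
    neg = -ₚ_

    ⊕≡+ₚ : ∀ f g → f ⊕ g ≡ f +ₚ g
    ⊕≡+ₚ f g = ≡.refl

    ⊗≡*ₚ : ∀ f g → f ⊗ g ≡ f *ₚ g
    ⊗≡*ₚ f g = ≡.refl

    neg≡-ₚ : ∀ f → neg f ≡ -ₚ f
    neg≡-ₚ f = ≡.refl

    polynomialIsCommutativeRing : IsCommutativeRing _≋_ _⊕_ _⊗_ neg [] (const 1#)
    polynomialIsCommutativeRing = record
      { isRing = record
        { +-isAbelianGroup = record
          { isGroup = record
            { isMonoid = record
              { isSemigroup = record
                { isMagma = record
                  { isEquivalence = record
                    { refl  = coeffwise (λ _ → refl)
                    ; sym   = λ p → coeffwise (λ n → sym (coeff-≈ p n))
                    ; trans = λ p q → coeffwise (λ n → trans (coeff-≈ p n) (coeff-≈ q n))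
                    }
                  ; ∙-cong = λ {f} {f′} {g} {g′} p q →
                      coeffwise (+ₚ-cong f f′ g g′ (coeff-≈ p) (coeff-≈ q))
                  }
                ; assoc = λ f g h → coeffwise (+ₚ-assoc f g h)
                }
              ; identity = (λ f → coeffwise (λ _ → refl)) , (λ f → coeffwise (+ₚ-identityʳ f))
              }
            ; inverse = (λ f → coeffwise (λ n → trans (+ₚ-comm (-ₚ f) f n) (-ₚ-inverseʳ f n)))
                      , (λ f → coeffwise (-ₚ-inverseʳ f))
            ; ⁻¹-cong = λ {f} {g} p → coeffwise (-ₚ-cong {f} {g} (coeff-≈ p))
            }
          ; comm = λ f g → coeffwise (+ₚ-comm f g)
          }
        ; *-cong = λ {f} {f′} {g} {g′} p q →
            coeffwise (*ₚ-cong f f′ g g′ (coeff-≈ p) (coeff-≈ q))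
        ; *-assoc = λ f g h → coeffwise (*ₚ-assoc f g h)
        ; *-identity = (λ f → coeffwise (*ₚ-identityˡ f))
                     , (λ f → coeffwise (λ n → trans (*ₚ-comm f (const 1#) n) (*ₚ-identityˡ f n)))
        ; distrib = (λ f g h → coeffwise (*ₚ-distribˡ f g h))
                  , (λ f g h → coeffwise (*ₚ-distribʳ f g h))
        }
      ; *-comm = λ f g → coeffwise (*ₚ-comm f g)
      }

  polynomialRing : CommutativeRing c ℓ
  polynomialRing = record { isCommutativeRing = polynomialIsCommutativeRing }

-- Ring homomorphisms: evaluation and maps on coefficients.

module _ {c₁ ℓ₁ c₂ ℓ₂} (R : CommutativeRing c₁ ℓ₁) (S : CommutativeRing c₂ ℓ₂) where
  private
    module R = CommutativeRing R
    module S = CommutativeRing S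
    module SP = Algebra.Properties.Ring S.ring
  open RingMorphisms R.rawRing S.rawRing public using (IsRingHomomorphism)

  ringHomomorphism : {h : R.Carrier → S.Carrier} →
    (∀ {x y} → x R.≈ y → h x S.≈ h y) →
    (∀ x y → h (x R.+ y) S.≈ h x S.+ h y) →
    (∀ x y → h (x R.* y) S.≈ h x S.* h y) →
    h R.1# S.≈ S.1# →
    IsRingHomomorphism h
  ringHomomorphism {h} h-cong h-+ h-* h-1 = record
    { isSemiringHomomorphism = record
      { isNearSemiringHomomorphism = record
        { +-isMonoidHomomorphism = record
          { isMagmaHomomorphism = record
            { isRelHomomorphism = record { cong = h-cong }
            ; homo = h-+
            }
          ; ε-homo = h-0
          }
        ; *-homo = h-*
        }
      ; 1#-homo = h-1
      }
    ; -‿homo = λ x → SP.+-inverseˡ-unique _ _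
        (S.trans (S.sym (h-+ _ _)) (S.trans (h-cong (R.-‿inverseˡ x)) h-0))
    }
    where
    h-0 : h R.0# S.≈ S.0#
    h-0 = SP.x+x≈x⇒x≈0 _ (S.trans (S.sym (h-+ _ _)) (h-cong (R.+-identityˡ _)))

module HomProperties {c₁ ℓ₁ c₂ ℓ₂} (R : CommutativeRing c₁ ℓ₁) (S : CommutativeRing c₂ ℓ₂)
  {h : CommutativeRing.Carrier R → CommutativeRing.Carrier S} (hom : IsRingHomomorphism R S h) where
  private
    module R = CommutativeRing R
    module S = CommutativeRing S
    module RE = Exp R.commutativeSemiring
    module SE = Exp S.commutativeSemiring
  open RingMorphisms.IsRingHomomorphism hom public using (+-homo; *-homo; -‿homo; 0#-homo; 1#-homo; ⟦⟧-cong)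

  ^-homo : ∀ x n → h (x RE.^ n) S.≈ h x SE.^ n
  ^-homo x zero    = 1#-homo
  ^-homo x (suc n) = S.trans (*-homo _ _) (S.*-congˡ (^-homo x n))

  sub-homo : ∀ x y → h (x R.- y) S.≈ h x S.- h y
  sub-homo x y = S.trans (+-homo _ _) (S.+-congˡ (-‿homo y))

module EvalHom {c ℓ} (R : CommutativeRing c ℓ) where
  open CommutativeRing R
  open Polynomial R using (_+ₚ_; _*ₚ_; _≈ₚ_; eval)
  open PolynomialLaws R
  open PolynomialRing R
  open IntegerSolver R
  open import Relation.Binary.Reasoning.Setoid setoid

  module _ (x : Carrier) where
    private
      ev : Poly → Carrier
      ev f = eval f x

    -- Zero has many representatives, because of trailing zeros. This case carries `eval-cong` past
    -- the end of the shorter list.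
    eval-zero : ∀ f → f ≈ₚ [] → ev f ≈ 0#
    eval-zero []      p = refl
    eval-zero (a ∷ f) p =
      trans (+-cong (p 0) (trans (*-congˡ (eval-zero f (λ n → p (suc n)))) (zeroʳ x))) (+-identityˡ 0#)

    eval-cong : ∀ f g → f ≈ₚ g → ev f ≈ ev g
    eval-cong []      g       p = sym (eval-zero g (λ n → sym (p n)))
    eval-cong (a ∷ f) []      p = eval-zero (a ∷ f) p
    eval-cong (a ∷ f) (b ∷ g) p = +-cong (p 0) (*-congˡ (eval-cong f g (λ n → p (suc n))))

    eval-+ : ∀ f g → ev (f +ₚ g) ≈ ev f + ev g
    eval-+ []      g       = sym (+-identityˡ _)
    eval-+ (a ∷ f) []      = sym (+-identityʳ _)
    eval-+ (a ∷ f) (b ∷ g) = begin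
      a + b + x * ev (f +ₚ g)           ≈⟨ +-congˡ (*-congˡ (eval-+ f g)) ⟩
      a + b + x * (ev f + ev g)         ≈⟨ solve 5
          (λ a b x u v → a :+ b :+ x :* (u :+ v) := a :+ x :* u :+ (b :+ x :* v)) refl _ _ _ _ _ ⟩
      a + x * ev f + (b + x * ev g)     ∎

    eval-scale : ∀ a f → ev (scale a f) ≈ a * ev f
    eval-scale a []      = sym (zeroʳ a)
    eval-scale a (b ∷ f) = trans (+-congˡ (*-congˡ (eval-scale a f)))
      (solve 4 (λ a b x u → a :* b :+ x :* (a :* u) := a :* (b :+ x :* u)) refl _ _ _ _)

    eval-* : ∀ f g → ev (f *ₚ g) ≈ ev f * ev g
    eval-* []      g = sym (zeroˡ _)
    eval-* (a ∷ f) g = begin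
      ev (scale a g +ₚ shift (f *ₚ g))          ≈⟨ eval-+ (scale a g) (shift (f *ₚ g)) ⟩
      ev (scale a g) + (0# + x * ev (f *ₚ g))   ≈⟨ +-cong (eval-scale a g) (+-congˡ (*-congˡ (eval-* f g))) ⟩
      a * ev g + (0# + x * (ev f * ev g))
          ≈⟨ solve 4 (λ a x u v → a :* v :+ (con (+ 0) :+ x :* (u :* v)) := (a :+ x :* u) :* v) refl _ _ _ _ ⟩
      (a + x * ev f) * ev g                     ∎

    eval-const : ∀ a → ev (const a) ≈ a
    eval-const a = trans (+-congˡ (zeroʳ x)) (+-identityʳ a)

    eval-X : ev X ≈ x
    eval-X = trans (+-identityˡ _) (trans (*-congˡ (eval-const 1#)) (*-identityʳ x))

    eval-hom : IsRingHomomorphism polynomialRing R ev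
    eval-hom = ringHomomorphism polynomialRing R
      (λ {f} {g} p → eval-cong f g (coeff-≈ p))
      (λ f g → trans (reflexive (≡.cong ev (⊕≡+ₚ f g))) (eval-+ f g))
      (λ f g → trans (reflexive (≡.cong ev (⊗≡*ₚ f g))) (eval-* f g))
      (eval-const 1#)

module MapHom {c₁ ℓ₁ c₂ ℓ₂} (R : CommutativeRing c₁ ℓ₁) (S : CommutativeRing c₂ ℓ₂)
  {h : CommutativeRing.Carrier R → CommutativeRing.Carrier S} (hom : IsRingHomomorphism R S h) where
  private
    module R = CommutativeRing R
    module S = CommutativeRing S
    module R[x] = PolynomialRing R
    module S[x] = PolynomialRing S
    module RL = PolynomialLaws R
    module SL = PolynomialLaws S
    module Rₚ = Polynomial R
    module Sₚ = Polynomial S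
  open HomProperties R S hom
  open import Relation.Binary.Reasoning.Setoid S.setoid

  coeff-map : ∀ f n → Sₚ.coeff (map h f) n S.≈ h (Rₚ.coeff f n)
  coeff-map []      n       = S.sym 0#-homo
  coeff-map (a ∷ f) zero    = S.refl
  coeff-map (a ∷ f) (suc n) = coeff-map f n

  shift-map : ∀ f n → Sₚ.coeff (SL.shift (map h f)) n S.≈ h (Rₚ.coeff (RL.shift f) n)
  shift-map f zero    = S.sym 0#-homo
  shift-map f (suc n) = coeff-map f n

  map-+ : ∀ f g → map h (f Rₚ.+ₚ g) Sₚ.≈ₚ map h f Sₚ.+ₚ map h g
  map-+ f g n = begin
    Sₚ.coeff (map h (f Rₚ.+ₚ g)) n                    ≈⟨ coeff-map (f Rₚ.+ₚ g) n ⟩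
    h (Rₚ.coeff (f Rₚ.+ₚ g) n)                        ≈⟨ ⟦⟧-cong (RL.coeff-+ f g n) ⟩
    h (Rₚ.coeff f n R.+ Rₚ.coeff g n)                 ≈⟨ +-homo _ _ ⟩
    h (Rₚ.coeff f n) S.+ h (Rₚ.coeff g n)             ≈⟨ S.+-cong (coeff-map f n) (coeff-map g n) ⟨
    Sₚ.coeff (map h f) n S.+ Sₚ.coeff (map h g) n     ≈⟨ SL.coeff-+ (map h f) (map h g) n ⟨
    Sₚ.coeff (map h f Sₚ.+ₚ map h g) n                ∎

  map-* : ∀ f g → map h (f Rₚ.*ₚ g) Sₚ.≈ₚ map h f Sₚ.*ₚ map h g
  map-* []      g n = S.refl
  map-* (a ∷ f) g n = begin
    Sₚ.coeff (map h ((a ∷ f) Rₚ.*ₚ g)) n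
      ≈⟨ coeff-map ((a ∷ f) Rₚ.*ₚ g) n ⟩
    h (Rₚ.coeff ((a ∷ f) Rₚ.*ₚ g) n)
      ≈⟨ ⟦⟧-cong (RL.coeff-∷* a f g n) ⟩
    h (a R.* Rₚ.coeff g n R.+ Rₚ.coeff (RL.shift (f Rₚ.*ₚ g)) n)
      ≈⟨ S.trans (+-homo _ _) (S.+-congʳ (*-homo _ _)) ⟩
    h a S.* h (Rₚ.coeff g n) S.+ h (Rₚ.coeff (RL.shift (f Rₚ.*ₚ g)) n)
      ≈⟨ S.+-cong (S.*-congˡ (coeff-map g n)) (shift-map (f Rₚ.*ₚ g) n) ⟨
    h a S.* Sₚ.coeff (map h g) n S.+ Sₚ.coeff (SL.shift (map h (f Rₚ.*ₚ g))) n
      ≈⟨ S.+-congˡ (SL.shift-cong (map-* f g) n) ⟩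
    h a S.* Sₚ.coeff (map h g) n S.+ Sₚ.coeff (SL.shift (map h f Sₚ.*ₚ map h g)) n
      ≈⟨ SL.coeff-∷* (h a) (map h f) (map h g) n ⟨
    Sₚ.coeff (map h (a ∷ f) Sₚ.*ₚ map h g) n ∎

  map-hom : IsRingHomomorphism R[x].polynomialRing S[x].polynomialRing (map h)
  map-hom = ringHomomorphism R[x].polynomialRing S[x].polynomialRing
    (λ {f} {g} p → S[x].coeffwise (λ n →
      S.trans (coeff-map f n) (S.trans (⟦⟧-cong (R[x].coeff-≈ p n)) (S.sym (coeff-map g n)))))
    (λ f g → ≡.subst₂ (λ u v → map h u S[x].≋ v) (≡.sym (R[x].⊕≡+ₚ f g)) (≡.sym (S[x].⊕≡+ₚ _ _))
        (S[x].coeffwise (map-+ f g)))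
    (λ f g → ≡.subst₂ (λ u v → map h u S[x].≋ v) (≡.sym (R[x].⊗≡*ₚ f g)) (≡.sym (S[x].⊗≡*ₚ _ _))
        (S[x].coeffwise (map-* f g)))
    (S[x].coeffwise λ { zero → 1#-homo ; (suc n) → S.refl })

-- Degree bounds, leading coefficients and synthetic division.

module Degree {c ℓ} (R : CommutativeRing c ℓ) where
  open CommutativeRing R hiding (zero)
  open Algebra.Properties.Ring ring
  open Polynomial R using (_≈ₚ_)
  open PolynomialLaws R
  open PolynomialRing R
  open IntegerSolver R
  open Exp commutativeSemiring using (_^_)
  open Exp (CommutativeRing.commutativeSemiring polynomialRing) using () renaming (_^_ to _^ᵖ_)
  open import Relation.Binary.Reasoning.Setoid setoid
  private module P = CommutativeRing polynomialRing

  coeff-⊕ : ∀ f g n → coeff (f ⊕ g) n ≈ coeff f n + coeff g n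
  coeff-⊕ f g n = trans (reflexive (≡.cong (λ h → coeff h n) (⊕≡+ₚ f g))) (coeff-+ f g n)

  coeff-⊖ : ∀ f n → coeff (neg f) n ≈ - coeff f n
  coeff-⊖ f n = trans (reflexive (≡.cong (λ h → coeff h n) (neg≡-ₚ f))) (coeff-neg f n)

  coeff-∷⊗ : ∀ a f g n → coeff ((a ∷ f) ⊗ g) n ≈ a * coeff g n + coeff (shift (f ⊗ g)) n
  coeff-∷⊗ a f g n = trans (reflexive (≡.cong (λ h → coeff h n) (⊗≡*ₚ (a ∷ f) g)))
    (trans (coeff-∷* a f g n) (+-congˡ (reflexive (≡.cong (λ h → coeff (shift h) n) (≡.sym (⊗≡*ₚ f g))))))

  Below : ℕ → Poly → Set ℓ
  Below d f = ∀ n → d ℕ.≤ n → coeff f n ≈ 0#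

  -- The coefficient `a` may be zero, so sums, products and powers can be treated over any
  -- commutative ring. Exact degrees arise by pairing this with a separate proof that `a` is
  -- nonzero.
  record Leading (f : Poly) (d : ℕ) (a : Carrier) : Set ℓ where
    constructor leading
    field
      lead  : coeff f d ≈ a
      below : Below (suc d) f
  open Leading public

  below-mono : ∀ {d e} f → d ℕ.≤ e → Below d f → Below e f
  below-mono f d≤e b n e≤n = b n (ℕ.≤-trans d≤e e≤n)

  below-⊕ : ∀ {d} f g → Below d f → Below d g → Below d (f ⊕ g)
  below-⊕ f g b b′ n d≤n = trans (coeff-⊕ f g n) (trans (+-cong (b n d≤n) (b′ n d≤n)) (+-identityˡ 0#))

  below-neg : ∀ {d} f → Below d f → Below d (neg f)
  below-neg f b n d≤n = trans (coeff-⊖ f n) (trans (-‿cong (b n d≤n)) -0#≈0#)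

  below-pred : ∀ {d} f → Below (suc d) f → coeff f d ≈ 0# → Below d f
  below-pred f b p n d≤n with ℕ.m≤n⇒m<n∨m≡n d≤n
  ... | inj₁ d<n    = b n d<n
  ... | inj₂ ≡.refl = p

  below-zero : ∀ f → Below 0 f → f ≋ []
  below-zero f b = coeffwise (λ n → b n z≤n)

  below-cong : ∀ {d f g} → f ≋ g → Below d f → Below d g
  below-cong f≋g b n d≤n = trans (sym (coeff-≈ f≋g n)) (b n d≤n)

  leading-cong : ∀ {f g d a b} → f ≋ g → a ≈ b → Leading f d a → Leading g d b
  leading-cong f≋g a≈b (leading l b) =
    leading (trans (sym (coeff-≈ f≋g _)) (trans l a≈b)) (below-cong f≋g b)

  leading-unique : ∀ {f d a b} → Leading f d a → Leading f d b → a ≈ b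
  leading-unique p q = trans (sym (lead p)) (lead q)

  leading-⊕ : ∀ {d a} f g → Leading f d a → Below d g → Leading (f ⊕ g) d a
  leading-⊕ f g (leading l b) b′ = leading
    (trans (coeff-⊕ f g _) (trans (+-cong l (b′ _ ℕ.≤-refl)) (+-identityʳ _)))
    (below-⊕ f g b (below-mono g (ℕ.n≤1+n _) b′))

  below-const : ∀ a → Below 1 (const a)
  below-const a (suc n) _ = refl

  leading-const : ∀ a → Leading (const a) 0 a
  leading-const a = leading refl (below-const a)

  leading-X : Leading X 1 1#
  leading-X = leading refl λ { (suc zero) (s≤s ()) ; (suc (suc n)) _ → refl }

  coeff-∷⊗[] : ∀ a f g → Below 0 f → ∀ n → coeff ((a ∷ f) ⊗ g) n ≈ a * coeff g n
  coeff-∷⊗[] a f g b n = trans (coeff-∷⊗ a f g n) (trans (+-congˡ (shift-[] f⊗g≈[] n)) (+-identityʳ _))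
    where
    f⊗g≈[] : f ⊗ g ≈ₚ []
    f⊗g≈[] = coeff-≈ (P.trans (P.*-congʳ (below-zero f b)) (P.zeroˡ g))

  const-⊗ : ∀ a b → const a ⊗ const b ≋ const (a * b)
  const-⊗ a b = coeffwise λ n → trans (coeff-∷⊗[] a [] (const b) (λ _ _ → refl) n) (lemma n)
    where
    lemma : ∀ n → a * coeff (const b) n ≈ coeff (const (a * b)) n
    lemma zero    = refl
    lemma (suc n) = zeroʳ a

  const-cong : ∀ {a b} → a ≈ b → const a ≋ const b
  const-cong a≈b = coeffwise λ { zero → a≈b ; (suc n) → refl }

  -- Turns the list constructor into ring operations, so that the solver can reason about
  -- polynomials built by recursion on lists.
  ∷≋ : ∀ c f → c ∷ f ≋ const c ⊕ X ⊗ f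
  ∷≋ c f = coeffwise λ n → sym (trans (coeff-⊕ (const c) (X ⊗ f) n) (trans (+-congˡ (X⊗ n)) (lemma n)))
    where
    X⊗ : ∀ n → coeff (X ⊗ f) n ≈ coeff (shift f) n
    X⊗ n = trans (coeff-∷⊗ 0# (const 1#) f n) (trans (+-congʳ (zeroˡ _)) (trans (+-identityˡ _) (one⊗ n)))
      where
      one⊗ : ∀ n → coeff (shift (const 1# ⊗ f)) n ≈ coeff (shift f) n
      one⊗ zero    = refl
      one⊗ (suc n) = coeff-≈ (P.*-identityˡ f) n
    lemma : ∀ n → coeff (const c) n + coeff (shift f) n ≈ coeff (c ∷ f) n
    lemma zero    = +-identityʳ c
    lemma (suc n) = +-identityˡ _

  const-hom : IsRingHomomorphism R polynomialRing const
  const-hom = ringHomomorphism R polynomialRing const-cong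
    (λ a b → coeffwise λ { zero    → sym (coeff-⊕ (const a) (const b) 0)
                         ; (suc n) → sym (trans (coeff-⊕ (const a) (const b) (suc n)) (+-identityˡ 0#)) })
    (λ a b → P.sym (const-⊗ a b)) P.refl

  leading-⊗ : ∀ {i j a b} f g → Leading f i a → Leading g j b → Leading (f ⊗ g) (i ℕ.+ j) (a * b)
  leading-⊗ {i} {j} {a} {b} [] g (leading l _) _ = leading
    (trans (coeff-≈ (P.zeroˡ g) (i ℕ.+ j)) (sym (trans (*-congʳ (sym l)) (zeroˡ b))))
    (λ n _ → coeff-≈ (P.zeroˡ g) n)
  leading-⊗ {zero} (c ∷ f) g (leading c≈a b) (leading l b′) = leading
    (trans (coeff-∷⊗[] c f g f₀ _) (*-cong c≈a l))
    (λ n j<n → trans (coeff-∷⊗[] c f g f₀ n) (trans (*-congˡ (b′ n j<n)) (zeroʳ c)))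
    where
    f₀ : Below 0 f
    f₀ n _ = b (suc n) (s≤s z≤n)
  leading-⊗ {suc i} {j} {a} {b} (c ∷ f) g (leading l b₁) (leading l′ b₂) = leading
    (begin
      coeff ((c ∷ f) ⊗ g) (suc (i ℕ.+ j))                ≈⟨ coeff-∷⊗ c f g _ ⟩
      c * coeff g (suc (i ℕ.+ j)) + coeff (f ⊗ g) (i ℕ.+ j)
          ≈⟨ +-cong (trans (*-congˡ (b₂ _ (s≤s (ℕ.m≤n+m j i)))) (zeroʳ c)) (lead ih) ⟩
      0# + a * b                                         ≈⟨ +-identityˡ _ ⟩
      a * b                                              ∎)
    λ { (suc n) (s≤s i+j<n) → begin
      coeff ((c ∷ f) ⊗ g) (suc n)                        ≈⟨ coeff-∷⊗ c f g (suc n) ⟩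
      c * coeff g (suc n) + coeff (f ⊗ g) n
          ≈⟨ +-cong (trans (*-congˡ (b₂ _ (s≤s (ℕ.≤-trans (ℕ.m≤n+m j (suc i)) i+j<n)))) (zeroʳ c)) (below ih n i+j<n) ⟩
      0# + 0#                                            ≈⟨ +-identityˡ 0# ⟩
      0#                                                 ∎ }
    where
    ih : Leading (f ⊗ g) (i ℕ.+ j) (a * b)
    ih = leading-⊗ f g (leading l (λ n i<n → b₁ (suc n) (s≤s i<n))) (leading l′ b₂)

  leading-^ : ∀ {d a} f → Leading f d a → ∀ n → Leading (f ^ᵖ n) (n ℕ.* d) (a ^ n)
  leading-^ f l zero    = leading-const 1#
  leading-^ f l (suc n) = leading-⊗ f (f ^ᵖ n) l (leading-^ f l n)

  -- Synthetic division: the quotient of f by X - a.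
  divLinear : Carrier → Poly → Poly
  divLinear a []      = []
  divLinear a (c ∷ f) = Polynomial.eval R f a ∷ divLinear a f

  open Polynomial R using (eval)
  open EvalHom R using (eval-zero)

  divLinear-below : ∀ a n f → Below (suc n) f → Below n (divLinear a f)
  divLinear-below a n []      b k n≤k = refl
  divLinear-below a n (c ∷ f) b zero z≤n = eval-zero a f (λ k → b (suc k) (s≤s z≤n))
  divLinear-below a zero (c ∷ f) b (suc k) _ = divLinear-below a zero f (λ m _ → b (suc m) (s≤s z≤n)) k z≤n
  divLinear-below a (suc n) (c ∷ f) b (suc k) (s≤s n≤k) =
    divLinear-below a n f (λ m n<m → b (suc m) (s≤s n<m)) k n≤k

  eval-divLinear : ∀ a f x → eval f x ≈ (x - a) * eval (divLinear a f) x + eval f a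
  eval-divLinear a [] x = sym (trans (+-identityʳ _) (zeroʳ _))
  eval-divLinear a (c ∷ f) x = begin
    c + x * eval f x
      ≈⟨ +-congˡ (*-congˡ (eval-divLinear a f x)) ⟩
    c + x * ((x - a) * eval (divLinear a f) x + eval f a)
      ≈⟨ solve 5 (λ c x a u v → c :+ x :* ((x :- a) :* u :+ v) := (x :- a) :* (v :+ x :* u) :+ (c :+ a :* v)) refl _ _ _ _ _ ⟩
    (x - a) * (eval f a + x * eval (divLinear a f) x) + (c + a * eval f a) ∎

  -- The entries of the quotient are the successive Horner values of `f` at `a`. Once these vanish,
  -- each Horner step c + a * 0 = 0 kills one coefficient.
  divLinear-[] : ∀ a f → divLinear a f ≈ₚ [] → eval f a ≈ 0# → f ≈ₚ []
  divLinear-[] a []      p f[a]≈0 n = refl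
  divLinear-[] a (c ∷ f) p f[a]≈0 zero = begin
    c                    ≈⟨ +-identityʳ c ⟨
    c + 0#               ≈⟨ +-congˡ (zeroʳ a) ⟨
    c + a * 0#           ≈⟨ +-congˡ (*-congˡ (p 0)) ⟨
    c + a * eval f a     ≈⟨ f[a]≈0 ⟩
    0#                   ∎
  divLinear-[] a (c ∷ f) p f[a]≈0 (suc n) = divLinear-[] a f (λ k → p (suc k)) (p 0) n

-- Fields with decidable equality and the count of roots.

-- The interface shared by the finite field and by the residue fields of its polynomial ring; the
-- latter are given without an enumeration.
record DiscreteField c ℓ : Set (lsuc (c ⊔ ℓ)) where
  field
    commutativeRing : CommutativeRing c ℓ
  open CommutativeRing commutativeRing public
  infix 4 _≟_
  field
    1≉0     : ¬ 1# ≈ 0#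
    inverse : ∀ x → ¬ x ≈ 0# → ∃[ y ] y * x ≈ 1#
    _≟_     : Decidable _≈_

module FieldProperties {c ℓ} (F : DiscreteField c ℓ) where
  open DiscreteField F hiding (zero)
  open Exp commutativeSemiring
  open IntegerSolver commutativeRing
  open import Relation.Binary.Reasoning.Setoid setoid

  *-cancelˡ : ∀ {x} y z → ¬ x ≈ 0# → x * y ≈ x * z → y ≈ z
  *-cancelˡ {x} y z x≉0 xy≈xz = let x⁻¹ , x⁻¹x≈1 = inverse x x≉0 in begin
    y                ≈⟨ *-identityˡ y ⟨
    1# * y           ≈⟨ *-congʳ x⁻¹x≈1 ⟨
    x⁻¹ * x * y      ≈⟨ *-assoc _ _ _ ⟩
    x⁻¹ * (x * y)    ≈⟨ *-congˡ xy≈xz ⟩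
    x⁻¹ * (x * z)    ≈⟨ *-assoc _ _ _ ⟨
    x⁻¹ * x * z      ≈⟨ *-congʳ x⁻¹x≈1 ⟩
    1# * z           ≈⟨ *-identityˡ z ⟩
    z                ∎

  xy≈0⇒y≈0 : ∀ {x y} → ¬ x ≈ 0# → x * y ≈ 0# → y ≈ 0#
  xy≈0⇒y≈0 x≉0 xy≈0 = *-cancelˡ _ _ x≉0 (trans xy≈0 (sym (zeroʳ _)))

  x*y≉0 : ∀ {x y} → ¬ x ≈ 0# → ¬ y ≈ 0# → ¬ x * y ≈ 0#
  x*y≉0 x≉0 y≉0 = y≉0 ∘ xy≈0⇒y≈0 x≉0

  x^n≉0 : ∀ {x} n → ¬ x ≈ 0# → ¬ x ^ n ≈ 0#
  x^n≉0 zero    x≉0 = 1≉0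
  x^n≉0 (suc n) x≉0 = x*y≉0 x≉0 (x^n≉0 n x≉0)

  x^n≈0⇒x≈0 : ∀ x n → x ^ n ≈ 0# → x ≈ 0#
  x^n≈0⇒x≈0 x n x^n≈0 with x ≟ 0#
  ... | yes x≈0 = x≈0
  ... | no  x≉0 = contradiction x^n≈0 (x^n≉0 n x≉0)

  1^n≈1 : ∀ n → 1# ^ n ≈ 1#
  1^n≈1 zero    = refl
  1^n≈1 (suc n) = trans (*-identityˡ _) (1^n≈1 n)

  x-y≈0⇒x≈y : ∀ {x y} → x - y ≈ 0# → x ≈ y
  x-y≈0⇒x≈y {x} {y} p = begin
    x           ≈⟨ solve 2 (λ x y → x := x :- y :+ y) refl x y ⟩
    x - y + y   ≈⟨ +-congʳ p ⟩
    0# + y      ≈⟨ +-identityˡ y ⟩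
    y           ∎

  x≈y⇒x-y≈0 : ∀ {x y} → x ≈ y → x - y ≈ 0#
  x≈y⇒x-y≈0 {x} {y} p = trans (+-congʳ p) (-‿inverseʳ y)

  open Polynomial commutativeRing using (eval; _≈ₚ_)
  open PolynomialRing commutativeRing using (Poly)
  open Degree commutativeRing

  -- Induction on the number of roots. Dividing by X - `s zero` lowers the degree bound by one, and
  -- the other points remain roots of the quotient because the linear factor does not vanish at
  -- them.
  roots-bound : ∀ n (s : Fin n → Carrier) → (∀ {i j} → s i ≈ s j → i ≡ j) →
    ∀ f → Below n f → (∀ i → eval f (s i) ≈ 0#) → f ≈ₚ []
  roots-bound zero    s s-inj f b roots k = b k z≤n
  roots-bound (suc n) s s-inj f b roots =
    divLinear-[] a f (roots-bound n (s ∘ suc) (Fin.suc-injective ∘ s-inj) (divLinear a f) (divLinear-below a n f b) roots′)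
      (roots zero)
    where
    a : Carrier
    a = s zero
    s≉a : ∀ i → ¬ s (suc i) - a ≈ 0#
    s≉a i p with () ← s-inj (x-y≈0⇒x≈y p)
    roots′ : ∀ i → eval (divLinear a f) (s (suc i)) ≈ 0#
    roots′ i = xy≈0⇒y≈0 (s≉a i) (begin
      (s (suc i) - a) * eval (divLinear a f) (s (suc i))              ≈⟨ +-identityʳ _ ⟨
      (s (suc i) - a) * eval (divLinear a f) (s (suc i)) + 0#         ≈⟨ +-congˡ (roots zero) ⟨
      (s (suc i) - a) * eval (divLinear a f) (s (suc i)) + eval f a   ≈⟨ eval-divLinear a f (s (suc i)) ⟨
      eval f (s (suc i))                                              ≈⟨ roots (suc i) ⟩
      0#                                                              ∎)

-- Quotients by a principal ideal.

module QuotientRing {c ℓ} (R : CommutativeRing c ℓ) (p : CommutativeRing.Carrier R) where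
  open CommutativeRing R
  open Divisibility semiring
  open IntegerSolver R

  infix 4 _≈ₘ_
  -- The quotient keeps the carrier and the operations and only coarsens the equality. The class of
  -- a polynomial is thus the polynomial itself, and evaluation in the residue field is composition
  -- of polynomials.
  _≈ₘ_ : Carrier → Carrier → Set (c ⊔ ℓ)
  x ≈ₘ y = p ∣ x - y

  ≈⇒≈ₘ : ∀ {x y} → x ≈ y → x ≈ₘ y
  ≈⇒≈ₘ {x} {y} x≈y = 0# , trans (zeroˡ p) (sym (trans (+-congʳ x≈y) (-‿inverseʳ y)))

  ≈ₘ0⇒∣ : ∀ {x} → x ≈ₘ 0# → p ∣ x
  ≈ₘ0⇒∣ {x} (q , e) = q , trans e (solve 1 (λ x → x :- con (+ 0) := x) refl x)

  ∣⇒≈ₘ0 : ∀ {x} → p ∣ x → x ≈ₘ 0#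
  ∣⇒≈ₘ0 {x} (q , e) = q , trans e (solve 1 (λ x → x := x :- con (+ 0)) refl x)

  quotientRing : CommutativeRing c (c ⊔ ℓ)
  quotientRing = record
    { Carrier = Carrier ; _≈_ = _≈ₘ_ ; _+_ = _+_ ; _*_ = _*_ ; -_ = -_ ; 0# = 0# ; 1# = 1#
    ; isCommutativeRing = record
      { isRing = record
        { +-isAbelianGroup = record
          { isGroup = record
            { isMonoid = record
              { isSemigroup = record
                { isMagma = record
                  { isEquivalence = record
                    { refl  = ≈⇒≈ₘ refl
                    ; sym   = λ { {x} {y} (q , e) → - q , trans (solve 2 (λ q p → :- q :* p := :- (q :* p)) refl q p)
                        (trans (-‿cong e) (solve 2 (λ x y → :- (x :- y) := y :- x) refl x y)) }
                    ; trans = λ { {x} {y} {z} (q , e) (q′ , e′) → q + q′ , trans (distribʳ p q q′)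
                        (trans (+-cong e e′)
                        (solve 3 (λ x y z → (x :- y) :+ (y :- z) := x :- z) refl x y z)) }
                    }
                  ; ∙-cong = λ { {x} {y} {u} {v} (q , e) (q′ , e′) → q + q′ , trans (distribʳ p q q′)
                      (trans (+-cong e e′)
                        (solve 4 (λ x y u v → (x :- y) :+ (u :- v) := x :+ u :- (y :+ v)) refl x y u v)) }
                  }
                ; assoc = λ x y z → ≈⇒≈ₘ (+-assoc x y z)
                }
              ; identity = (≈⇒≈ₘ ∘ +-identityˡ) , (≈⇒≈ₘ ∘ +-identityʳ)
              }
            ; inverse = (≈⇒≈ₘ ∘ -‿inverseˡ) , (≈⇒≈ₘ ∘ -‿inverseʳ)
            ; ⁻¹-cong = λ { {x} {y} (q , e) → - q , trans (solve 2 (λ q p → :- q :* p := :- (q :* p)) refl q p)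
                        (trans (-‿cong e) (solve 2 (λ x y → :- (x :- y) := :- x :- :- y) refl x y)) }
            }
          ; comm = λ x y → ≈⇒≈ₘ (+-comm x y)
          }
        -- The quotient comes from x u - y v = u (x - y) + y (u - v).
        ; *-cong = λ { {x} {y} {u} {v} (q , e) (q′ , e′) → u * q + y * q′ ,
            trans (solve 5 (λ p u q y q′ → (u :* q :+ y :* q′) :* p := u :* (q :* p) :+ y :* (q′ :* p)) refl p u q y q′)
              (trans (+-cong (*-congˡ e) (*-congˡ e′))
                (solve 4 (λ x y u v → u :* (x :- y) :+ y :* (u :- v) := x :* u :- y :* v) refl x y u v)) }
        ; *-assoc = λ x y z → ≈⇒≈ₘ (*-assoc x y z)
        ; *-identity = (≈⇒≈ₘ ∘ *-identityˡ) , (≈⇒≈ₘ ∘ *-identityʳ)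
        ; distrib = (λ x y z → ≈⇒≈ₘ (distribˡ x y z)) , (λ x y z → ≈⇒≈ₘ (distribʳ x y z))
        }
      ; *-comm = λ x y → ≈⇒≈ₘ (*-comm x y)
      }
    }

-- Euclidean division, irreducible factors and residue fields.

module FieldPolynomials {c ℓ} (F : DiscreteField c ℓ) where
  open DiscreteField F hiding (zero)
  open FieldProperties F
  open PolynomialRing commutativeRing
  open Degree commutativeRing
  private
    module P = CommutativeRing polynomialRing
    module D = Divisibility P.semiring
  open IntegerSolver polynomialRing
  open Exp P.commutativeSemiring using () renaming (_^_ to _^ᵖ_)
  open Primality P.semiring using (Irreducible; mkIrred) public
  open D using (_∣_; _,_) public
  open import Relation.Binary.Reasoning.Setoid P.setoid

  leading? : ∀ f → f ≋ [] ⊎ (∃[ d ] ∃[ a ] ¬ a ≈ 0# × Leading f d a)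
  leading? [] = inj₁ P.refl
  leading? (c ∷ f) with leading? f
  ... | inj₂ (d , a , a≉0 , l) = inj₂ (suc d , a , a≉0 , leading (lead l) λ { (suc n) (s≤s d<n) → below l n d<n })
  ... | inj₁ f≋[] with c ≟ 0#
  ...   | yes c≈0 = inj₁ (coeffwise λ { zero → c≈0 ; (suc n) → coeff-≈ f≋[] n })
  ...   | no  c≉0 = inj₂ (0 , c , c≉0 , leading refl λ { (suc n) _ → coeff-≈ f≋[] n })

  monic-^ : ∀ f → Leading f 1 1# → ∀ n → Leading (f ^ᵖ n) n 1#
  monic-^ f l n = ≡.subst (λ d → Leading (f ^ᵖ n) d 1#) (ℕ.*-identityʳ n)
    (leading-cong P.refl (1^n≈1 n) (leading-^ f l n))

  leading-below : ∀ {d e a} f → ¬ a ≈ 0# → Leading f d a → Below e f → d ℕ.< e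
  leading-below {d} {e} f a≉0 l b with d ℕ.<? e
  ... | yes d<e = d<e
  ... | no  d≮e = contradiction (trans (sym (lead l)) (b d (ℕ.≮⇒≥ d≮e))) a≉0

  degree-unique : ∀ {d e a b} f → ¬ a ≈ 0# → ¬ b ≈ 0# → Leading f d a → Leading f e b → d ≡ e
  degree-unique f a≉0 b≉0 l l′ = ℕ.≤-antisym
    (ℕ.≤-pred (leading-below f a≉0 l (below l′))) (ℕ.≤-pred (leading-below f b≉0 l′ (below l)))

  leading≉0 : ∀ {d a f} → ¬ a ≈ 0# → Leading f d a → ¬ f ≋ []
  leading≉0 {f = f} a≉0 l f≋[] with () ← leading-below {e = 0} f a≉0 l (λ n _ → coeff-≈ f≋[] n)

  factors-leading : ∀ {d a} f g h → f ⊗ g ≋ h → ¬ a ≈ 0# → Leading h d a →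
    ∃[ i ] ∃[ j ] ∃[ b ] ∃[ c ] ¬ b ≈ 0# × ¬ c ≈ 0# × Leading f i b × Leading g j c × i ℕ.+ j ≡ d
  factors-leading f g h fg≋h a≉0 l with leading? f | leading? g
  ... | inj₁ f≋[] | _ = contradiction (P.trans (P.sym fg≋h) (P.trans (P.*-congʳ f≋[]) (P.zeroˡ g))) (leading≉0 a≉0 l)
  ... | _ | inj₁ g≋[] = contradiction (P.trans (P.sym fg≋h) (P.trans (P.*-congˡ g≋[]) (P.zeroʳ f))) (leading≉0 a≉0 l)
  ... | inj₂ (i , b , b≉0 , lf) | inj₂ (j , c , c≉0 , lg) = i , j , b , c , b≉0 , c≉0 , lf , lg ,
    degree-unique h (x*y≉0 b≉0 c≉0) a≉0 (leading-cong fg≋h refl (leading-⊗ f g lf lg)) l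

  ∣⇒≤ : ∀ {d e a b} f g → f ∣ g → ¬ a ≈ 0# → Leading f d a → ¬ b ≈ 0# → Leading g e b → d ℕ.≤ e
  ∣⇒≤ f g (q , qf≋g) a≉0 lf b≉0 lg with factors-leading q f g qf≋g b≉0 lg
  ... | i , j , _ , _ , _ , c≉0 , _ , lf′ , ≡.refl with degree-unique f a≉0 c≉0 lf lf′
  ...   | ≡.refl = ℕ.m≤n+m j i

  leading-0⇒const : ∀ {f a} → Leading f 0 a → f ≋ const a
  leading-0⇒const l = coeffwise λ { zero → lead l ; (suc n) → below l (suc n) (s≤s z≤n) }

  leading-0⇒∣1 : ∀ {f a} → ¬ a ≈ 0# → Leading f 0 a → f ∣ P.1#
  leading-0⇒∣1 {f} {a} a≉0 l = let a⁻¹ , a⁻¹a≈1 = inverse a a≉0 in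
    const a⁻¹ , P.trans (P.*-congˡ (leading-0⇒const l)) (P.trans (const-⊗ a⁻¹ a) (const-cong a⁻¹a≈1))

  ∣1⇒leading-0 : ∀ {d a} f → f ∣ P.1# → ¬ a ≈ 0# → Leading f d a → d ≡ 0
  ∣1⇒leading-0 f f∣1 a≉0 l = ℕ.n≤0⇒n≡0 (∣⇒≤ f P.1# f∣1 a≉0 l 1≉0 (leading-const 1#))

  -- Recursion on the coefficients of the dividend. If f = q g + r, then c + X f = X q g + (c + X
  -- r), and c + X r has degree at most d, so subtracting a single constant multiple `t` of `g`
  -- restores the bound.
  division : ∀ {d b} g → ¬ b ≈ 0# → Leading g d b → ∀ f → ∃[ q ] ∃[ r ] f ≋ q ⊗ g ⊕ r × Below d r
  division g b≉0 l [] = [] , [] , solve 1 (λ g → con (+ 0) := con (+ 0) :* g :+ con (+ 0)) P.refl g , λ _ _ → refl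
  division {d} {b} g b≉0 l (c ∷ f) with division g b≉0 l f | inverse b b≉0
  ... | q , r , f≋ , r-below | b⁻¹ , b⁻¹b≈1 = t ∷ q , r′ , eq , below-pred r′ r′-below r′-coeff
    where
    t = coeff (c ∷ r) d * b⁻¹
    r′ = (c ∷ r) ⊕ neg (const t ⊗ g)
    lt : Leading (const t ⊗ g) d (t * b)
    lt = leading-⊗ (const t) g (leading-const t) l
    r′-below : Below (suc d) r′
    r′-below = below-⊕ (c ∷ r) (neg (const t ⊗ g)) (λ { (suc n) (s≤s d≤n) → r-below n d≤n })
      (below-neg (const t ⊗ g) (below lt))
    tb≈ : t * b ≈ coeff (c ∷ r) d
    tb≈ = trans (*-assoc _ _ _) (trans (*-congˡ b⁻¹b≈1) (*-identityʳ _))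
    r′-coeff : coeff r′ d ≈ 0#
    r′-coeff = trans (coeff-⊕ (c ∷ r) (neg (const t ⊗ g)) d)
      (trans (+-congˡ (trans (coeff-⊖ (const t ⊗ g) d) (-‿cong (trans (lead lt) tb≈)))) (-‿inverseʳ _))
    eq : c ∷ f ≋ (t ∷ q) ⊗ g ⊕ r′
    eq = begin
      c ∷ f                                                                     ≈⟨ ∷≋ c f ⟩
      const c ⊕ X ⊗ f                                                           ≈⟨ P.+-congˡ (P.*-congˡ f≋) ⟩
      const c ⊕ X ⊗ (q ⊗ g ⊕ r)
        ≈⟨ solve 6 (λ c t x q g r → c :+ x :* (q :* g :+ r) := (t :+ x :* q) :* g :+ ((c :+ x :* r) :- t :* g)) P.refl
             (const c) (const t) X q g r ⟩
      (const t ⊕ X ⊗ q) ⊗ g ⊕ ((const c ⊕ X ⊗ r) ⊕ neg (const t ⊗ g))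
        ≈⟨ P.+-cong (P.*-congʳ (∷≋ t q)) (P.+-congʳ (∷≋ c r)) ⟨
      (t ∷ q) ⊗ g ⊕ r′ ∎

  -- Euclid's algorithm; the degree bound `n` on the second argument makes the recursion structural,
  -- since the remainder has a strictly smaller bound.
  bezout : ∀ n f g → Below n g → ∃[ h ] h ∣ f × h ∣ g × ∃[ u ] ∃[ v ] u ⊗ f ⊕ v ⊗ g ≋ h
  bezout zero f g b = f , D.∣-refl , ([] , P.trans (P.zeroˡ f) (P.sym (below-zero g b))) , P.1# , [] ,
    solve 2 (λ f g → con (+ 1) :* f :+ con (+ 0) :* g := f) P.refl f g
  bezout (suc n) f g b with leading? g
  ... | inj₁ g≋[] = f , D.∣-refl , ([] , P.trans (P.zeroˡ f) (P.sym g≋[])) , P.1# , [] ,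
    solve 2 (λ f g → con (+ 1) :* f :+ con (+ 0) :* g := f) P.refl f g
  ... | inj₂ (d , a , a≉0 , l) with division g a≉0 l f
  ...   | q , r , f≋ , r-below with bezout n g r (below-mono r (ℕ.≤-pred (leading-below g a≉0 l b)) r-below)
  ...     | h , (s , sh≋g) , (t , th≋r) , u , v , eq = h ,
    (q ⊗ s ⊕ t , (begin
      (q ⊗ s ⊕ t) ⊗ h       ≈⟨ solve 4 (λ q s t h → (q :* s :+ t) :* h := q :* (s :* h) :+ t :* h) P.refl q s t h ⟩
      q ⊗ (s ⊗ h) ⊕ t ⊗ h   ≈⟨ P.+-cong (P.*-congˡ sh≋g) th≋r ⟩
      q ⊗ g ⊕ r             ≈⟨ f≋ ⟨
      f                     ∎)) ,
    (s , sh≋g) , v , u ⊕ neg (v ⊗ q) , (begin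
      v ⊗ f ⊕ (u ⊕ neg (v ⊗ q)) ⊗ g             ≈⟨ P.+-congʳ (P.*-congˡ f≋) ⟩
      v ⊗ (q ⊗ g ⊕ r) ⊕ (u ⊕ neg (v ⊗ q)) ⊗ g
        ≈⟨ solve 5 (λ u v q g r → v :* (q :* g :+ r) :+ (u :- v :* q) :* g := u :* g :+ v :* r) P.refl u v q g r ⟩
      u ⊗ g ⊕ v ⊗ r                             ≈⟨ eq ⟩
      h                                         ∎)

  below-some : ∀ f → ∃[ n ] Below n f
  below-some f with leading? f
  ... | inj₁ f≋[] = 0 , λ n _ → coeff-≈ f≋[] n
  ... | inj₂ (d , _ , _ , l) = suc d , below l

  -- Let h be the common divisor from `bezout`, with p = s h. If s is a unit then p divides h and so
  -- f; if h is a unit then the Bézout identity can be rescaled to 1.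
  irreducible-bezout : ∀ {p} → Irreducible p → ∀ f → p ∣ f ⊎ (∃[ u ] ∃[ v ] u ⊗ p ⊕ v ⊗ f ≋ P.1#)
  irreducible-bezout {p} (mkIrred _ split) f with below-some f
  ... | n , b with bezout n p f b
  ...   | h , (s , sh≋p) , h∣f@(t , th≋f) , u , v , eq with split (P.sym sh≋p)
  ...     | inj₁ (k , ks≋1) = inj₁ (D.∣-trans (k , (begin
    k ⊗ p         ≈⟨ P.*-congˡ sh≋p ⟨
    k ⊗ (s ⊗ h)   ≈⟨ P.*-assoc k s h ⟨
    k ⊗ s ⊗ h     ≈⟨ P.*-congʳ ks≋1 ⟩
    P.1# ⊗ h      ≈⟨ P.*-identityˡ h ⟩
    h             ∎)) h∣f)
  ...     | inj₂ (k , kh≋1) = inj₂ (k ⊗ u , k ⊗ v , (begin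
    k ⊗ u ⊗ p ⊕ k ⊗ v ⊗ f     ≈⟨ solve 5 (λ k u p v f → k :* u :* p :+ k :* v :* f := k :* (u :* p :+ v :* f)) P.refl k u p v f ⟩
    k ⊗ (u ⊗ p ⊕ v ⊗ f)       ≈⟨ P.*-congˡ eq ⟩
    k ⊗ h                     ≈⟨ kh≋1 ⟩
    P.1#                      ∎))

  ∣∧degree≡⇒associated : ∀ {d a b} f g → f ∣ g → ¬ a ≈ 0# → Leading f d a → ¬ b ≈ 0# → Leading g d b →
    ∃[ c ] c * a ≈ b × const c ⊗ f ≋ g
  ∣∧degree≡⇒associated {d} f g (q , qf≋g) a≉0 lf b≉0 lg with factors-leading q f g qf≋g b≉0 lg
  ... | i , j , c , a′ , _ , a′≉0 , lq , lf′ , i+j≡d with degree-unique f a≉0 a′≉0 lf lf′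
  ...   | ≡.refl with ℕ.+-cancelʳ-≡ d i 0 i+j≡d
  ...     | ≡.refl = c , leading-unique (leading-cong qf≋g refl (leading-⊗ q f lq lf)) lg ,
    P.trans (P.*-congʳ (P.sym (leading-0⇒const lq))) qf≋g

  ∤1 : ∀ {d a} f → ¬ a ≈ 0# → Leading f d a → 1 ℕ.≤ d → ¬ f ∣ P.1#
  ∤1 f a≉0 l 1≤d f∣1 = ℕ.<-irrefl (≡.sym (∣1⇒leading-0 f f∣1 a≉0 l)) 1≤d

  -- If no irreducible polynomial divided `f`, then `f` could not split into factors of positive
  -- degree, as the induction hypothesis refutes this for the first factor. So `f` would be
  -- irreducible and divide itself. Assuming the absence of factors replaces any search for one,
  -- hence the double negation.
  ¬¬-irreducible-factor : ∀ n {d a} f → d ℕ.≤ n → 1 ℕ.≤ d → ¬ a ≈ 0# → Leading f d a →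
    ¬ (∀ p → Irreducible p → ¬ p ∣ f)
  ¬¬-irreducible-factor zero    f z≤n () a≉0 l none
  ¬¬-irreducible-factor (suc n) f d≤n 1≤d a≉0 l none = none f (mkIrred (∤1 f a≉0 l 1≤d) split) D.∣-refl
    where
    split : ∀ {g h} → f ≋ g ⊗ h → g ∣ P.1# ⊎ h ∣ P.1#
    split {g} {h} f≋gh with factors-leading g h f (P.sym f≋gh) a≉0 l
    ... | zero , _ , _ , _ , b≉0 , _ , lg , _ = inj₁ (leading-0⇒∣1 b≉0 lg)
    ... | suc i , zero , _ , _ , _ , c≉0 , _ , lh , _ = inj₂ (leading-0⇒∣1 c≉0 lh)
    ... | suc i , suc j , b , _ , b≉0 , _ , lg , _ , ≡.refl = contradiction
      (λ p p-irr p∣g → none p p-irr (D.∣-trans p∣g (h , P.trans (P.*-comm h g) (P.sym f≋gh))))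
      (¬¬-irreducible-factor n g (ℕ.≤-pred (ℕ.≤-trans (s≤s (ℕ.m<m+n i (s≤s z≤n))) d≤n)) (s≤s z≤n) b≉0 lg)

  -- In a factorisation into two factors of positive degree, an irreducible factor of the first has
  -- degree less than d. The goal of that branch is absurd, so the doubly negated existence of such
  -- a factor suffices.
  no-small-factor⇒irreducible : ∀ {d a} f → 1 ℕ.≤ d → ¬ a ≈ 0# → Leading f d a →
    (∀ {e b} p → Irreducible p → p ∣ f → ¬ b ≈ 0# → Leading p e b → d ℕ.≤ e) → Irreducible f
  no-small-factor⇒irreducible {d} f 1≤d a≉0 l large = mkIrred (∤1 f a≉0 l 1≤d) split
    where
    split : ∀ {g h} → f ≋ g ⊗ h → g ∣ P.1# ⊎ h ∣ P.1#
    split {g} {h} f≋gh with factors-leading g h f (P.sym f≋gh) a≉0 l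
    ... | zero , _ , _ , _ , b≉0 , _ , lg , _ = inj₁ (leading-0⇒∣1 b≉0 lg)
    ... | suc i , zero , _ , _ , _ , c≉0 , _ , lh , _ = inj₂ (leading-0⇒∣1 c≉0 lh)
    ... | suc i , suc j , b , _ , b≉0 , _ , lg , _ , ≡.refl = contradiction none
      (¬¬-irreducible-factor (suc i) g ℕ.≤-refl (s≤s z≤n) b≉0 lg)
      where
      none : ∀ p → Irreducible p → ¬ p ∣ g
      none p p-irr p∣g@(q , qp≋g) with factors-leading q p g qp≋g b≉0 lg
      ... | _ , _ , _ , _ , _ , c≉0 , _ , lp , _ = ℕ.<⇒≱ (s≤s (ℕ.m<m+n i (s≤s z≤n)))
        (ℕ.≤-trans (large p p-irr (D.∣-trans p∣g (h , P.trans (P.*-comm h g) (P.sym f≋gh))) c≉0 lp)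
          (∣⇒≤ p g p∣g c≉0 lp b≉0 lg))

  module Residue {p : Poly} (p-irreducible : Irreducible p) where
    open Irreducible p-irreducible
    open QuotientRing polynomialRing p

    private
      p∤ : ∀ {f} u v → u ⊗ p ⊕ v ⊗ f ≋ P.1# → ¬ p ∣ f
      p∤ {f} u v eq (q , qp≋f) = p∤1 (u ⊕ v ⊗ q , (begin
        (u ⊕ v ⊗ q) ⊗ p      ≈⟨ solve 4 (λ u v q p → (u :+ v :* q) :* p := u :* p :+ v :* (q :* p)) P.refl u v q p ⟩
        u ⊗ p ⊕ v ⊗ (q ⊗ p)  ≈⟨ P.+-congˡ (P.*-congˡ qp≋f) ⟩
        u ⊗ p ⊕ v ⊗ f        ≈⟨ eq ⟩
        P.1#                 ∎))

    -- The two outcomes of `irreducible-bezout` decide divisibility by `p` and hence equality; in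
    -- the second outcome the cofactor of `f` is its inverse.
    residueField : DiscreteField c (c ⊔ ℓ)
    residueField = record
      { commutativeRing = quotientRing
      ; 1≉0     = p∤1 ∘ ≈ₘ0⇒∣
      ; inverse = inv
      ; _≟_     = dec
      }
      where
      inv : ∀ f → ¬ f ≈ₘ P.0# → ∃[ g ] g ⊗ f ≈ₘ P.1#
      inv f f≉0 with irreducible-bezout p-irreducible f
      ... | inj₁ p∣f = contradiction (∣⇒≈ₘ0 p∣f) f≉0
      ... | inj₂ (u , v , eq) = v , (neg u , (begin
        neg u ⊗ p                    ≈⟨ solve 3 (λ u p w → :- u :* p := w :- (u :* p :+ w)) P.refl u p (v ⊗ f) ⟩
        v ⊗ f ⊕ neg (u ⊗ p ⊕ v ⊗ f)  ≈⟨ P.+-congˡ (P.-‿cong eq) ⟩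
        v ⊗ f ⊕ neg P.1#             ∎))
      dec : Decidable _≈ₘ_
      dec f g with irreducible-bezout p-irreducible (f ⊕ neg g)
      ... | inj₁ p∣f-g        = yes p∣f-g
      ... | inj₂ (u , v , eq) = no (p∤ u v eq)

-- Finite fields: Fermat's theorem and the criterion for r-th powers.

module Finite {c ℓ m} (K : FiniteField (suc m) c ℓ) where
  private
    module K = FiniteField K
  open K using (Carrier; _≈_; _*_; _+_; _-_; -_; 0#; 1#; sym; trans; refl; reflexive; setoid; commutativeRing;
    *-cong; *-congˡ; *-congʳ; *-identityˡ; *-identityʳ; *-assoc; *-comm; +-congˡ; +-cong; +-identityˡ; zeroˡ; zeroʳ)
  open Exp K.commutativeSemiring
  open Inverse K.enumeration
    using () renaming (to to index; from to element; to-cong to index-cong; from-cong to element-cong;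
                       strictlyInverseˡ to index-element; strictlyInverseʳ to element-index) public

  index-injective : ∀ {x y} → index x ≡ index y → x ≈ y
  index-injective {x} {y} p = trans (sym (element-index x)) (trans (element-cong p) (element-index y))

  element-injective : ∀ {i j} → element i ≈ element j → i ≡ j
  element-injective {i} {j} p = ≡.trans (≡.sym (index-element i)) (≡.trans (index-cong p) (index-element j))

  discreteField : DiscreteField c ℓ
  discreteField = record
    { commutativeRing = commutativeRing
    ; 1≉0     = K.1≉0
    ; inverse = λ x x≉0 → let x⁻¹ , p , _ = K.invertible x x≉0 in x⁻¹ , p
    ; _≟_     = λ x y → map′ index-injective index-cong (index x Fin.≟ index y)
    }
  open DiscreteField discreteField using (_≟_; inverse; 1≉0)
  open FieldProperties discreteField
  open FieldPolynomials discreteField using (monic-^)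
  open IntegerSolver commutativeRing
  open Sum K.*-commutativeMonoid
    using (sum-remove; ∑-distrib-+; sum-permute; sum-cong-≋; sum-replicate) renaming (sum to product)
  open import Relation.Binary.Reasoning.Setoid setoid

  private
    ifZero : Carrier → Carrier → Carrier → Carrier
    ifZero x u v with x ≟ 0#
    ... | yes _ = u
    ... | no  _ = v

    ifZero-yes : ∀ {x} u v → x ≈ 0# → ifZero x u v ≈ u
    ifZero-yes {x} u v p with x ≟ 0#
    ... | yes _  = refl
    ... | no x≉0 = contradiction p x≉0

    ifZero-no : ∀ {x} u v → ¬ x ≈ 0# → ifZero x u v ≈ v
    ifZero-no {x} u v x≉0 with x ≟ 0#
    ... | yes p = contradiction p x≉0
    ... | no _  = refl

    -- Sending `0#` to `1#` lets the product of the nonzero elements be taken over the whole of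
    -- `Fin (suc m)`.
    unit : Carrier → Carrier
    unit x = ifZero x 1# x

    unit-cong : ∀ {x y} → x ≈ y → unit x ≈ unit y
    unit-cong {x} {y} x≈y with x ≟ 0#
    ... | yes x≈0 = sym (ifZero-yes 1# y (trans (sym x≈y) x≈0))
    ... | no  x≉0 = trans x≈y (sym (ifZero-no 1# y (x≉0 ∘ trans x≈y)))

    unit≉0 : ∀ x → ¬ unit x ≈ 0#
    unit≉0 x with x ≟ 0#
    ... | yes _  = 1≉0
    ... | no x≉0 = x≉0

    -- The factor due to `a` is 1 at zero and `a` at each of the remaining m elements, which is how
    -- the exponent m arises in Fermat's theorem.
    unit-* : ∀ {a} x → ¬ a ≈ 0# → unit (a * x) ≈ ifZero x 1# a * unit x
    unit-* {a} x a≉0 with x ≟ 0#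
    ... | yes x≈0 = trans (ifZero-yes 1# _ (trans (*-congˡ x≈0) (zeroʳ a))) (sym (*-identityˡ 1#))
    ... | no  x≉0 = ifZero-no 1# _ (x*y≉0 a≉0 x≉0)

    product≉0 : ∀ {n} (f : Fin n → Carrier) → (∀ i → ¬ f i ≈ 0#) → ¬ product f ≈ 0#
    product≉0 {zero}  f f≉0 = 1≉0
    product≉0 {suc n} f f≉0 = x*y≉0 (f≉0 zero) (product≉0 (f ∘ suc) (f≉0 ∘ suc))

    multiply : ∀ a → ¬ a ≈ 0# → Permutation (suc m) (suc m)
    multiply a a≉0 = permutation
      (λ i → index (a * element i)) (λ i → index (a⁻¹ * element i))
      (inv (trans (*-comm a a⁻¹) a⁻¹a≈1)) (inv a⁻¹a≈1)
      where
      a⁻¹ = proj₁ (inverse a a≉0)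
      a⁻¹a≈1 = proj₂ (inverse a a≉0)
      inv : ∀ {x y} → x * y ≈ 1# → ∀ i → index (x * element (index (y * element i))) ≡ i
      inv {x} {y} xy≈1 i = ≡.trans (index-cong (begin
        x * element (index (y * element i))   ≈⟨ *-congˡ (element-index _) ⟩
        x * (y * element i)                   ≈⟨ *-assoc _ _ _ ⟨
        x * y * element i                     ≈⟨ *-congʳ xy≈1 ⟩
        1# * element i                        ≈⟨ *-identityˡ _ ⟩
        element i                             ∎)) (index-element i)

  -- Multiplication by a permutes the nonzero elements, so a ^ m leaves their product unchanged.
  fermat-unit : ∀ a → ¬ a ≈ 0# → a ^ m ≈ 1#
  fermat-unit a a≉0 = *-cancelˡ _ _ (product≉0 w (λ i → unit≉0 (element i))) (begin
    product w * a ^ m                     ≈⟨ *-comm _ _ ⟩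
    a ^ m * product w                     ≈⟨ *-congʳ product-α ⟨
    product α * product w                 ≈⟨ ∑-distrib-+ α w ⟨
    product (λ i → α i * w i)
        ≈⟨ sum-cong-≋ (λ i → sym (trans (unit-cong (element-index _)) (unit-* (element i) a≉0))) ⟩
    product (λ i → w (multiply a a≉0 ⟨$⟩ʳ i))
      ≈⟨ sum-permute w (multiply a a≉0) ⟨
    product w                             ≈⟨ *-identityʳ _ ⟨
    product w * 1#                        ∎)
    where
    w α : Fin (suc m) → Carrier
    w i = unit (element i)
    α i = ifZero (element i) 1# a
    α≈a : ∀ j → α (punchIn (index 0#) j) ≈ a
    α≈a j = ifZero-no 1# a (λ p → Fin.punchInᵢ≢i (index 0#) j
      (≡.trans (≡.sym (index-element _)) (index-cong p)))
    product-α : product α ≈ a ^ m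
    product-α = begin
      product α                                          ≈⟨ sum-remove {i = index 0#} α ⟩
      α (index 0#) * product (α ∘ punchIn (index 0#))
          ≈⟨ *-cong (ifZero-yes 1# a (element-index 0#)) (sum-cong-≋ α≈a) ⟩
      1# * product {m} (λ _ → a)                         ≈⟨ *-identityˡ _ ⟩
      product {m} (λ _ → a)                              ≈⟨ sum-replicate m ⟩
      a ^ m                                              ∎

  fermat : ∀ a → a ^ suc m ≈ a
  fermat a with a ≟ 0#
  ... | yes a≈0 = trans (*-congʳ a≈0) (trans (zeroˡ _) (sym a≈0))
  ... | no  a≉0 = trans (*-congˡ (fermat-unit a a≉0)) (*-identityʳ a)

  open PolynomialRing commutativeRing
  open Polynomial commutativeRing using (eval)
  open Degree commutativeRing
  open EvalHom commutativeRing
  private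
    module P = CommutativeRing polynomialRing
    module PE = Exp P.commutativeSemiring

    -- The quotient (X ^ (r * n) - c ^ n) / (X ^ r - c).
    geometric : ℕ → Carrier → ℕ → Poly
    geometric r c zero    = []
    geometric r c (suc n) = X PE.^ r ⊗ geometric r c n ⊕ const (c ^ n)

    eval-geometric : ∀ r c n a → (a ^ r - c) * eval (geometric r c n) a + c ^ n ≈ (a ^ r) ^ n
    eval-geometric r c zero    a = solve 2 (λ x c → (x :- c) :* con (+ 0) :+ con (+ 1) := con (+ 1)) refl (a ^ r) c
    eval-geometric r c (suc n) a = begin
      (a ^ r - c) * eval (X PE.^ r ⊗ V ⊕ const (c ^ n)) a + c * c ^ n
        ≈⟨ K.+-congʳ (*-congˡ (trans (E.+-homo _ _)
            (+-cong (trans (E.*-homo _ _) (*-congʳ (trans (E.^-homo X r) (^-congˡ r (eval-X a)))))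
                (eval-const a (c ^ n))))) ⟩
      (a ^ r - c) * (a ^ r * eval V a + c ^ n) + c * c ^ n
        ≈⟨ solve 4 (λ x c v y → (x :- c) :* (x :* v :+ y) :+ c :* y := x :* ((x :- c) :* v :+ y)) refl (a ^ r) c
            (eval V a) (c ^ n) ⟩
      a ^ r * ((a ^ r - c) * eval V a + c ^ n)
        ≈⟨ *-congˡ (eval-geometric r c n a) ⟩
      a ^ r * (a ^ r) ^ n ∎
      where
      V = geometric r c n
      module E = HomProperties polynomialRing commutativeRing (eval-hom a)

    geometric-leading : ∀ r c n → 1 ℕ.≤ r → Leading (geometric r c (suc n)) (n ℕ.* r) 1#
    geometric-leading r c zero    1≤r = leading-cong (P.sym (P.trans (P.+-congʳ (P.zeroʳ _)) (P.+-identityˡ _))) refl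
        (leading-const 1#)
    geometric-leading r c (suc n) 1≤r = leading-⊕ _ (const (c ^ suc n))
      (leading-cong P.refl (*-identityˡ 1#)
          (leading-⊗ (X PE.^ r) (geometric r c (suc n)) (monic-^ X leading-X r) (geometric-leading r c n 1≤r)))
      (below-mono (const (c ^ suc n)) (ℕ.≤-trans 1≤r (ℕ.m≤m+n r _)) (below-const _))

  -- If c were not an r-th power, all field elements would be roots of X * (X ^ m - c ^ e) / (X ^ r - c).
  power-criterion : ∀ r e c → r ℕ.* e ≡ m → 1 ℕ.≤ m → c ^ e ≈ 1# → ∃[ b ] c ≈ b ^ r
  power-criterion r e c re≡m 1≤m c^e≈1 with Fin.any? (λ i → c ≟ element i ^ r)
  ... | yes (i , p) = element i , p
  power-criterion r zero c re≡m 1≤m c^e≈1 | no _ =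
    contradiction (ℕ.≤-trans 1≤m (ℕ.≤-reflexive (≡.trans (≡.sym re≡m) (ℕ.*-zeroʳ r)))) λ ()
  power-criterion zero (suc e) c re≡m 1≤m c^e≈1 | no _ =
    contradiction (ℕ.≤-trans 1≤m (ℕ.≤-reflexive (≡.sym re≡m))) λ ()
  power-criterion r@(suc r′) (suc e) c re≡m 1≤m c^e≈1 | no notPower =
    contradiction (trans (sym (lead f-leading))
        (roots-bound (suc m) element element-injective f f-below (λ i → root (element i)) _)) 1≉0
    where
    V f : Poly
    V = geometric r c (suc e)
    f = X ⊗ V
    f-leading : Leading f (suc (e ℕ.* r)) 1#
    f-leading = leading-cong P.refl (*-identityˡ 1#) (leading-⊗ X V leading-X (geometric-leading r c e (s≤s z≤n)))
    -- With exponent `suc e` the degree of `f` is 1 + e r, and r ≥ 1 gives 1 + e r ≤ r + e r = m,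
    -- one less than the number of elements.
    f-below : Below (suc m) f
    f-below = below-mono f (s≤s (ℕ.≤-trans (s≤s (ℕ.m≤n+m _ r′)) (ℕ.≤-reflexive (≡.trans (ℕ.*-comm (suc e) r) re≡m))))
        (below f-leading)
    notRoot : ∀ a → ¬ a ^ r - c ≈ 0#
    notRoot a p = notPower (index a , trans (sym (x-y≈0⇒x≈y p)) (^-congˡ r (sym (element-index a))))
    root : ∀ a → eval f a ≈ 0#
    root a with a ≟ 0#
    ... | yes a≈0 = trans (E.*-homo X V) (trans (*-congʳ (trans (eval-X a) a≈0)) (zeroˡ _))
      where module E = HomProperties polynomialRing commutativeRing (eval-hom a)
    ... | no a≉0 = trans (E.*-homo X V) (trans (*-congˡ (xy≈0⇒y≈0 (notRoot a) V[a]≈0)) (zeroʳ _))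
      where
      module E = HomProperties polynomialRing commutativeRing (eval-hom a)
      V[a]≈0 : (a ^ r - c) * eval V a ≈ 0#
      V[a]≈0 = begin
        (a ^ r - c) * eval V a                           ≈⟨ solve 2 (λ x y → x := x :+ y :- y) refl _ (c ^ suc e) ⟩
        (a ^ r - c) * eval V a + c ^ suc e - c ^ suc e   ≈⟨ K.+-cong (eval-geometric r c (suc e) a) (K.-‿cong c^e≈1) ⟩
        (a ^ r) ^ suc e - 1#
            ≈⟨ K.+-congʳ (trans (^-assocʳ a r (suc e)) (^-congʳ a re≡m)) ⟩
        a ^ m - 1#                                       ≈⟨ x≈y⇒x-y≈0 (fermat-unit a a≉0) ⟩
        0#                                               ∎

-- The Frobenius map on an extension M of K, its conjugates and norms.

module Frobenius {c ℓ c′ ℓ′ n} (𝕂 : FiniteField (2 ℕ.+ n) c ℓ) (𝕄 : DiscreteField c′ ℓ′)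
  {ι : FiniteField.Carrier 𝕂 → DiscreteField.Carrier 𝕄}
  (ι-hom : IsRingHomomorphism (FiniteField.commutativeRing 𝕂) (DiscreteField.commutativeRing 𝕄) ι)
  where

  private
    q : ℕ
    q = 2 ℕ.+ n
    module K = FiniteField 𝕂
    module KF = Finite 𝕂
    module KE = Exp K.commutativeSemiring
    module KP = PolynomialRing K.commutativeRing
    module KD = Degree K.commutativeRing
    module KFP = FieldPolynomials KF.discreteField
    module Kf = FieldProperties KF.discreteField
    module K[x] = CommutativeRing KP.polynomialRing
    module ι = HomProperties K.commutativeRing (DiscreteField.commutativeRing 𝕄) ι-hom
  open DiscreteField 𝕄 hiding (zero)
  open FieldProperties 𝕄
  open FieldPolynomials 𝕄 using (monic-^)
  open Exp commutativeSemiring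
  open PolynomialRing commutativeRing
  open Polynomial commutativeRing using (eval)
  open Degree commutativeRing
  open EvalHom commutativeRing
  private
    module P = CommutativeRing polynomialRing
    module PE = Exp P.commutativeSemiring
    module Eval x = HomProperties polynomialRing commutativeRing (eval-hom x)
  open IntegerSolver commutativeRing
  open import Relation.Binary.Reasoning.Setoid setoid

  φ : Carrier → Carrier
  φ z = z ^ q

  ι-injective : ∀ {a b} → ι a ≈ ι b → a K.≈ b
  ι-injective {a} {b} p with DiscreteField._≟_ KF.discreteField (a K.- b) K.0#
  ... | yes a-b≈0 = Kf.x-y≈0⇒x≈y a-b≈0
  ... | no  a-b≉0 = let w , w*[a-b]≈1 = DiscreteField.inverse KF.discreteField _ a-b≉0 in
    contradiction (begin
      1#                       ≈⟨ ι.1#-homo ⟨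
      ι K.1#                   ≈⟨ ι.⟦⟧-cong w*[a-b]≈1 ⟨
      ι (w K.* (a K.- b))      ≈⟨ trans (ι.*-homo _ _) (*-congˡ (ι.sub-homo a b)) ⟩
      ι w * (ι a - ι b)        ≈⟨ *-congˡ (x≈y⇒x-y≈0 p) ⟩
      ι w * 0#                 ≈⟨ zeroʳ _ ⟩
      0#                       ∎) 1≉0

  φ-cong : ∀ {x y} → x ≈ y → φ x ≈ φ y
  φ-cong = ^-congˡ q

  φ-ι : ∀ a → φ (ι a) ≈ ι a
  φ-ι a = trans (sym (ι.^-homo a q)) (ι.⟦⟧-cong (KF.fermat a))

  private
    eval-X^ : ∀ z k → eval (X PE.^ k) z ≈ z ^ k
    eval-X^ z k = trans (Eval.^-homo z X k) (^-congˡ k (eval-X z))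

  -- X ^ q - X is monic of degree q, as q ≥ 2, and vanishes on the q elements of K. A fixed point
  -- outside K would be one root too many.
  fixed⇒∈K : ∀ z → φ z ≈ z → ∃[ a ] z ≈ ι a
  fixed⇒∈K z φz≈z with Fin.any? (λ i → z ≟ ι (KF.element i))
  ... | yes (i , p) = KF.element i , p
  ... | no z∉K = contradiction
    (trans (sym (lead f-leading)) (roots-bound (suc q) s s-injective f (below f-leading) roots q)) 1≉0
    where
    f : Poly
    f = X PE.^ q ⊕ neg X
    f-leading : Leading f q 1#
    f-leading = leading-⊕ (X PE.^ q) (neg X) (monic-^ X leading-X q)
      (below-neg X (below-mono X (s≤s (s≤s z≤n)) (below leading-X)))
    s : Fin (suc q) → Carrier
    s zero    = z
    s (suc i) = ι (KF.element i)
    s-injective : ∀ {i j} → s i ≈ s j → i ≡ j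
    s-injective {zero}  {zero}  p = ≡.refl
    s-injective {zero}  {suc j} p = contradiction (j , p) z∉K
    s-injective {suc i} {zero}  p = contradiction (i , sym p) z∉K
    s-injective {suc i} {suc j} p = ≡.cong suc (KF.element-injective (ι-injective p))
    root : ∀ x → φ x ≈ x → eval f x ≈ 0#
    root x φx≈x = trans (Eval.sub-homo x (X PE.^ q) X)
        (trans (+-cong (eval-X^ x q) (-‿cong (eval-X x))) (x≈y⇒x-y≈0 φx≈x))
    roots : ∀ i → eval f (s i) ≈ 0#
    roots zero    = root z φz≈z
    roots (suc i) = root _ (φ-ι _)

  -- (1 + X) ^ q - X ^ q - 1 has degree less than q and vanishes on K.
  φ-1+ : ∀ z → φ (1# + z) ≈ 1# + φ z
  φ-1+ z = begin
    φ (1# + z)                      ≈⟨ solve 3 (λ a b c → a := c :+ b :+ (a :- b :- c)) refl _ (φ z) 1# ⟩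
    1# + φ z + (φ (1# + z) - φ z - 1#)
      ≈⟨ +-congˡ (trans (sym (eval-f z)) (eval-zero z f
          (roots-bound q (ι ∘ KF.element) (KF.element-injective ∘ ι-injective) f f-below (roots ∘ KF.element)))) ⟩
    1# + φ z + 0#                   ≈⟨ +-identityʳ _ ⟩
    1# + φ z                        ∎
    where
    1+X f₁ f₂ f : Poly
    1+X = X ⊕ P.1#
    f₁ = 1+X PE.^ q
    f₂ = f₁ ⊕ neg (X PE.^ q)
    f = f₂ ⊕ neg P.1#
    f₁-leading : Leading f₁ q 1#
    f₁-leading = monic-^ 1+X (leading-⊕ X P.1# leading-X (below-const 1#)) q
    X^q-leading : Leading (X PE.^ q) q 1#
    X^q-leading = monic-^ X leading-X q
    f-below : Below q f
    f-below = below-⊕ f₂ (neg P.1#)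
      (below-pred f₂ (below-⊕ f₁ (neg (X PE.^ q)) (below f₁-leading) (below-neg (X PE.^ q) (below X^q-leading)))
        (trans (coeff-⊕ f₁ (neg (X PE.^ q)) q)
            (trans (+-cong (lead f₁-leading) (trans (coeff-⊖ (X PE.^ q) q) (-‿cong (lead X^q-leading))))
                (-‿inverseʳ 1#))))
      (below-neg P.1# (below-mono P.1# (s≤s z≤n) (below-const 1#)))
    eval-f : ∀ x → eval f x ≈ φ (1# + x) - φ x - 1#
    eval-f x = trans (Eval.sub-homo x f₂ P.1#) (+-cong (trans (Eval.sub-homo x f₁ (X PE.^ q)) (+-cong
      (trans (Eval.^-homo x 1+X q) (^-congˡ q
          (trans (Eval.+-homo x X P.1#) (trans (+-comm _ _) (+-cong (Eval.1#-homo x) (eval-X x))))))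
      (-‿cong (eval-X^ x q)))) (-‿cong (Eval.1#-homo x)))
    roots : ∀ a → eval f (ι a) ≈ 0#
    roots a = begin
      eval f (ι a)                        ≈⟨ eval-f (ι a) ⟩
      φ (1# + ι a) - φ (ι a) - 1#         ≈⟨ +-congʳ (+-cong (φ-cong 1+ιa) (-‿cong (φ-ι a))) ⟩
      φ (ι (K.1# K.+ a)) - ι a - 1#       ≈⟨ +-congʳ (+-congʳ (trans (φ-ι _) (sym 1+ιa))) ⟩
      1# + ι a - ι a - 1#                 ≈⟨ solve 2 (λ x y → x :+ y :- y :- x := con (+ 0)) refl 1# (ι a) ⟩
      0#                                  ∎
      where
      1+ιa : 1# + ι a ≈ ι (K.1# K.+ a)
      1+ιa = trans (+-congʳ (sym ι.1#-homo)) (sym (ι.+-homo _ _))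

  φ-* : ∀ x y → φ (x * y) ≈ φ x * φ y
  φ-* x y = ^-distrib-* x y q

  -- Multiplicativity reduces the sum to `φ-1+`: for x nonzero, x + y = x (1 + t) with t = y / x.
  φ-+ : ∀ x y → φ (x + y) ≈ φ x + φ y
  φ-+ x y with x ≟ 0#
  ... | yes x≈0 = begin
    φ (x + y)     ≈⟨ φ-cong (trans (+-congʳ x≈0) (+-identityˡ y)) ⟩
    φ y           ≈⟨ +-identityˡ _ ⟨
    0# + φ y      ≈⟨ +-congʳ (trans (φ-cong x≈0) (zeroˡ _)) ⟨
    φ x + φ y     ∎
  ... | no  x≉0 = begin
    φ (x + y)                 ≈⟨ φ-cong (+-congˡ xt≈y) ⟨
    φ (x + x * t)             ≈⟨ φ-cong (solve 2 (λ x t → x :+ x :* t := x :* (con (+ 1) :+ t)) refl x t) ⟩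
    φ (x * (1# + t))          ≈⟨ φ-* _ _ ⟩
    φ x * φ (1# + t)          ≈⟨ *-congˡ (φ-1+ t) ⟩
    φ x * (1# + φ t)          ≈⟨ solve 2 (λ x t → x :* (con (+ 1) :+ t) := x :+ x :* t) refl (φ x) (φ t) ⟩
    φ x + φ x * φ t           ≈⟨ +-congˡ (trans (sym (φ-* x t)) (φ-cong xt≈y)) ⟩
    φ x + φ y                 ∎
    where
    t = proj₁ (inverse x x≉0) * y
    xt≈y : x * t ≈ y
    xt≈y = begin
      x * (proj₁ (inverse x x≉0) * y)   ≈⟨ solve 3 (λ x w y → x :* (w :* y) := w :* x :* y) refl x _ y ⟩
      proj₁ (inverse x x≉0) * x * y     ≈⟨ *-congʳ (proj₂ (inverse x x≉0)) ⟩
      1# * y                            ≈⟨ *-identityˡ y ⟩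
      y                                 ∎

  φ-hom : IsRingHomomorphism commutativeRing commutativeRing φ
  φ-hom = ringHomomorphism commutativeRing commutativeRing φ-cong φ-+ φ-* (1^n≈1 q)
  private module φ = HomProperties commutativeRing commutativeRing φ-hom

  φ-injective : ∀ {x y} → φ x ≈ φ y → x ≈ y
  φ-injective {x} {y} p = x-y≈0⇒x≈y (x^n≈0⇒x≈0 (x - y) q (trans (φ.sub-homo x y) (x≈y⇒x-y≈0 p)))

  φ^ : ℕ → Carrier → Carrier
  φ^ zero    z = z
  φ^ (suc k) z = φ (φ^ k z)

  φ^-cong : ∀ k {x y} → x ≈ y → φ^ k x ≈ φ^ k y
  φ^-cong zero    p = p
  φ^-cong (suc k) p = φ-cong (φ^-cong k p)

  φ^-φ : ∀ k z → φ^ k (φ z) ≡ φ (φ^ k z)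
  φ^-φ zero    z = ≡.refl
  φ^-φ (suc k) z = ≡.cong φ (φ^-φ k z)

  φ^-+ : ∀ j k z → φ^ (j ℕ.+ k) z ≡ φ^ j (φ^ k z)
  φ^-+ zero    k z = ≡.refl
  φ^-+ (suc j) k z = ≡.cong φ (φ^-+ j k z)

  φ^-hom : ∀ k → IsRingHomomorphism commutativeRing commutativeRing (φ^ k)
  φ^-hom zero = ringHomomorphism commutativeRing commutativeRing id (λ _ _ → refl) (λ _ _ → refl) refl
  φ^-hom (suc k) = ringHomomorphism commutativeRing commutativeRing (φ^-cong (suc k))
    (λ x y → trans (φ-cong (F.+-homo x y)) (φ-+ _ _)) (λ x y → trans (φ-cong (F.*-homo x y)) (φ-* _ _))
    (trans (φ-cong F.1#-homo) (1^n≈1 q))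
    where module F = HomProperties commutativeRing commutativeRing (φ^-hom k)
  module φ^ k = HomProperties commutativeRing commutativeRing (φ^-hom k)

  φ^-ι : ∀ k a → φ^ k (ι a) ≈ ι a
  φ^-ι zero    a = refl
  φ^-ι (suc k) a = trans (φ-cong (φ^-ι k a)) (φ-ι a)

  φ^-injective : ∀ k {x y} → φ^ k x ≈ φ^ k y → x ≈ y
  φ^-injective zero    p = p
  φ^-injective (suc k) p = φ^-injective k (φ-injective p)

  evalι : KP.Poly → Carrier → Carrier
  evalι f z = eval (map ι f) z

  evalι-hom : ∀ z → IsRingHomomorphism KP.polynomialRing commutativeRing (λ f → evalι f z)
  evalι-hom z = Composition.isRingHomomorphism trans
    (MapHom.map-hom K.commutativeRing commutativeRing ι-hom) (eval-hom z)
  module evalι z = HomProperties KP.polynomialRing commutativeRing (evalι-hom z)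

  -- The coefficients lie in K and are fixed by φ. In particular φ sends roots of `f` to roots of
  -- `f`.
  evalι-φ^ : ∀ k f z → evalι f (φ^ k z) ≈ φ^ k (evalι f z)
  evalι-φ^ k []      z = sym (φ^.0#-homo k)
  evalι-φ^ k (a ∷ f) z = begin
    ι a + φ^ k z * evalι f (φ^ k z)            ≈⟨ +-cong (sym (φ^-ι k a)) (*-congˡ (evalι-φ^ k f z)) ⟩
    φ^ k (ι a) + φ^ k z * φ^ k (evalι f z)     ≈⟨ +-congˡ (φ^.*-homo k _ _) ⟨
    φ^ k (ι a) + φ^ k (z * evalι f z)          ≈⟨ φ^.+-homo k _ _ ⟨
    φ^ k (ι a + z * evalι f z)                 ∎

  evalι-ι : ∀ f a → evalι f (ι a) ≈ ι (K.eval f a)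
  evalι-ι []      a = sym ι.0#-homo
  evalι-ι (b ∷ f) a = trans (+-congˡ (trans (*-congˡ (evalι-ι f a)) (sym (ι.*-homo _ _)))) (sym (ι.+-homo _ _))

  -- A product of k conjugates, which lies in K when `φ^ k` fixes `z`. For `w` it is taken with k =
  -- d although `φ^ d` may move `w`; the power q - 1 of the product measures by what factor.
  norm : ℕ → Carrier → Carrier
  norm zero    z = 1#
  norm (suc k) z = norm k z * φ^ k z

  norm-cong : ∀ k {x y} → x ≈ y → norm k x ≈ norm k y
  norm-cong zero    p = refl
  norm-cong (suc k) p = *-cong (norm-cong k p) (φ^-cong k p)

  norm-* : ∀ k x y → norm k (x * y) ≈ norm k x * norm k y
  norm-* zero    x y = sym (*-identityˡ 1#)
  norm-* (suc k) x y = trans (*-cong (norm-* k x y) (φ^.*-homo k x y))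
    (solve 4 (λ a b c d → a :* b :* (c :* d) := a :* c :* (b :* d)) refl _ _ _ _)

  norm-1 : ∀ k → norm k 1# ≈ 1#
  norm-1 zero    = refl
  norm-1 (suc k) = trans (*-cong (norm-1 k) (φ^.1#-homo k)) (*-identityˡ 1#)

  norm-^ : ∀ k x r → norm k (x ^ r) ≈ norm k x ^ r
  norm-^ k x zero    = norm-1 k
  norm-^ k x (suc r) = trans (norm-* k x (x ^ r)) (*-congˡ (norm-^ k x r))

  norm-ι : ∀ k a → norm k (ι a) ≈ ι (a KE.^ k)
  norm-ι zero    a = sym ι.1#-homo
  norm-ι (suc k) a = trans (*-cong (norm-ι k a) (φ^-ι k a)) (trans (sym (ι.*-homo _ _)) (ι.⟦⟧-cong (K.*-comm _ _)))

  -- As `suc n` is q - 1, the power of each factor is the ratio of two consecutive conjugates. The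
  -- form without quotients also covers z = 0.
  φ^≈norm^*id : ∀ k z → φ^ k z ≈ norm k z ^ suc n * z
  φ^≈norm^*id zero    z = sym (trans (*-congʳ (1^n≈1 (suc n))) (*-identityˡ z))
  φ^≈norm^*id (suc k) z = begin
    φ^ k z * φ^ k z ^ suc n                   ≈⟨ *-congʳ (φ^≈norm^*id k z) ⟩
    norm k z ^ suc n * z * φ^ k z ^ suc n     ≈⟨ solve 3 (λ a b c → a :* b :* c := a :* c :* b) refl _ _ _ ⟩
    norm k z ^ suc n * φ^ k z ^ suc n * z     ≈⟨ *-congʳ (^-distrib-* (norm k z) (φ^ k z) (suc n)) ⟨
    (norm k z * φ^ k z) ^ suc n * z           ∎

  norm≈0⇒≈0 : ∀ k z → norm k z ≈ 0# → z ≈ 0#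
  norm≈0⇒≈0 k z p = φ^-injective k (trans (φ^≈norm^*id k z)
    (trans (*-congʳ (trans (*-congʳ p) (zeroˡ _))) (trans (zeroˡ z) (sym (φ^.0#-homo k)))))

  private
    X-_ : Carrier → Poly
    X- z = X ⊕ neg (const z)

  conjugates : ℕ → Carrier → Poly
  conjugates zero    z = P.1#
  conjugates (suc k) z = conjugates k z ⊗ X- φ^ k z

  -- Splits off the first factor where the definition splits off the last. This exhibits `z` as a
  -- root and closes the cycle when `φ^ (suc k)` fixes `z`.
  conjugates-∷ : ∀ k z → X- z ⊗ conjugates k (φ z) ≋ conjugates (suc k) z
  conjugates-∷ zero    z = P.*-comm _ _
  conjugates-∷ (suc k) z = P.trans (P.sym (P.*-assoc _ _ _)) (P.*-cong (conjugates-∷ k z)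
    (P.+-congˡ (P.-‿cong (const-cong (reflexive (φ^-φ k z))))))

  X-leading : ∀ z → Leading (X- z) 1 1#
  X-leading z = leading-⊕ X (neg (const z)) leading-X (below-neg (const z) (below-const z))

  conjugates-leading : ∀ k z → Leading (conjugates k z) k 1#
  conjugates-leading zero    z = leading-const 1#
  conjugates-leading (suc k) z = leading-cong P.refl (*-identityˡ 1#)
    (≡.subst (λ d → Leading (conjugates (suc k) z) d (1# * 1#)) (ℕ.+-comm k 1)
      (leading-⊗ (conjugates k z) (X- φ^ k z) (conjugates-leading k z) (X-leading _)))

  private
    eval-X- : ∀ z x → eval (X- z) x ≈ x - z
    eval-X- z x = trans (Eval.sub-homo x X (const z)) (+-cong (eval-X x) (-‿cong (eval-const x z)))

  -- Elements of K are fixed by φ, so each factor `ι a` minus a conjugate of `z` is the same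
  -- conjugate of `ι a - z`.
  conjugates-eval : ∀ k z a → eval (conjugates k z) (ι a) ≈ norm k (ι a - z)
  conjugates-eval zero    z a = Eval.1#-homo (ι a)
  conjugates-eval (suc k) z a = trans (Eval.*-homo (ι a) (conjugates k z) (X- φ^ k z))
    (*-cong (conjugates-eval k z a) (begin
      eval (X- φ^ k z) (ι a)    ≈⟨ eval-X- (φ^ k z) (ι a) ⟩
      ι a - φ^ k z              ≈⟨ +-congʳ (φ^-ι k a) ⟨
      φ^ k (ι a) - φ^ k z       ≈⟨ φ^.sub-homo k _ _ ⟨
      φ^ k (ι a - z)            ∎))

  conjugates-root : ∀ k z → eval (conjugates (suc k) z) z ≈ 0#
  conjugates-root k z = begin
    eval (conjugates (suc k) z) z                   ≈⟨ Eval.⟦⟧-cong z (conjugates-∷ k z) ⟨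
    eval (X- z ⊗ conjugates k (φ z)) z              ≈⟨ Eval.*-homo z (X- z) (conjugates k (φ z)) ⟩
    eval (X- z) z * eval (conjugates k (φ z)) z     ≈⟨ *-congʳ (trans (eval-X- z z) (-‿inverseʳ z)) ⟩
    0# * eval (conjugates k (φ z)) z                ≈⟨ zeroˡ _ ⟩
    0#                                              ∎

  conjugates-cong : ∀ k {x y} → x ≈ y → conjugates k x ≋ conjugates k y
  conjugates-cong zero    p = P.refl
  conjugates-cong (suc k) p = P.*-cong (conjugates-cong k p) (P.+-congˡ (P.-‿cong (const-cong (φ^-cong k p))))

  map-φ-conjugates : ∀ k z → map φ (conjugates k z) ≋ conjugates k (φ z)
  map-φ-conjugates k z = go k
    where
    module Mφ = HomProperties polynomialRing polynomialRing (MapHom.map-hom commutativeRing commutativeRing φ-hom)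
    go : ∀ k → map φ (conjugates k z) ≋ conjugates k (φ z)
    go zero    = Mφ.1#-homo
    go (suc k) = P.trans (Mφ.*-homo (conjugates k z) (X- φ^ k z)) (P.*-cong (go k)
      (P.trans (Mφ.sub-homo X (const (φ^ k z))) (P.+-cong
        (coeffwise λ { zero → φ.0#-homo ; (suc zero) → φ.1#-homo ; (suc (suc _)) → refl })
        (P.-‿cong (const-cong (reflexive (≡.sym (φ^-φ k z))))))))

  -- If φ^ (suc k) fixes z, then φ permutes the factors of conjugates (suc k) z cyclically.
  conjugates-fixed : ∀ k z → φ^ (suc k) z ≈ z → map φ (conjugates (suc k) z) ≋ conjugates (suc k) z
  conjugates-fixed k z p = P.trans (map-φ-conjugates (suc k) z) (P.trans
    (P.*-congˡ (P.+-congˡ (P.-‿cong (const-cong (trans (reflexive (φ^-φ k z)) p)))))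
    (P.trans (P.*-comm _ _) (conjugates-∷ k z)))

  -- Galois descent, one coefficient at a time, through `fixed⇒∈K`.
  descend : ∀ f → (∀ k → φ (coeff f k) ≈ coeff f k) → ∃[ g ] map ι g ≋ f
  descend []      fixed = [] , P.refl
  descend (z ∷ f) fixed with fixed⇒∈K z (fixed 0) | descend f (λ k → fixed (suc k))
  ... | a , z≈ιa | g , ιg≋f = a ∷ g , coeffwise λ { zero → sym z≈ιa ; (suc k) → coeff-≈ ιg≋f k }

  descend-conjugates : ∀ k z → φ^ (suc k) z ≈ z → ∃[ g ] map ι g ≋ conjugates (suc k) z
  descend-conjugates k z p = descend (conjugates (suc k) z) λ j →
    trans (sym (MapHom.coeff-map commutativeRing commutativeRing φ-hom (conjugates (suc k) z) j))
      (coeff-≈ (conjugates-fixed k z p) j)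

  private
    coeff-ι : ∀ g k → coeff (map ι g) k ≈ ι (K.coeff g k)
    coeff-ι = MapHom.coeff-map K.commutativeRing commutativeRing ι-hom

  leading-descend : ∀ {g f d} → map ι g ≋ f → Leading f d 1# → KD.Leading g d K.1#
  leading-descend {g} {f} {d} ιg≋f l = KD.leading
    (ι-injective (trans (sym (coeff-ι g d)) (trans (coeff-≈ ιg≋f d) (trans (lead l) (sym ι.1#-homo)))))
    (λ k d<k → ι-injective (trans (sym (coeff-ι g k))
        (trans (coeff-≈ ιg≋f k) (trans (below l k d<k) (sym ι.0#-homo)))))

  module Root {g : KP.Poly} {d l} (g-irreducible : KFP.Irreducible g) (l≉0 : ¬ l K.≈ K.0#)
    (g-leading : KD.Leading g d l) {z : Carrier} (g[z]≈0 : evalι g z ≈ 0#) where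

    -- Up to a constant `g` is the minimal polynomial of `z`: were `h` not a multiple of `g`, the
    -- Bézout identity evaluated at `z` would read 1 = 0.
    g∣annihilator : ∀ h → evalι h z ≈ 0# → g KFP.∣ h
    g∣annihilator h h[z]≈0 with KFP.irreducible-bezout g-irreducible h
    ... | inj₁ g∣h = g∣h
    ... | inj₂ (u , v , eq) = contradiction (begin
      1#                                        ≈⟨ evalι.1#-homo z ⟨
      evalι K[x].1# z                           ≈⟨ evalι.⟦⟧-cong z eq ⟨
      evalι (u KP.⊗ g KP.⊕ v KP.⊗ h) z
          ≈⟨ trans (evalι.+-homo z _ _) (+-cong (evalι.*-homo z u g) (evalι.*-homo z v h)) ⟩
      evalι u z * evalι g z + evalι v z * evalι h z
        ≈⟨ +-cong (trans (*-congˡ g[z]≈0) (zeroʳ _)) (trans (*-congˡ h[z]≈0) (zeroʳ _)) ⟩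
      0# + 0#                                   ≈⟨ +-identityˡ 0# ⟩
      0#                                        ∎) 1≉0

    module _ {k} (period : φ^ (suc k) z ≈ z) where
      private
        h = proj₁ (descend-conjugates k z period)
        ιh≋ : map ι h ≋ conjugates (suc k) z
        ιh≋ = proj₂ (descend-conjugates k z period)
        h-leading : KD.Leading h (suc k) K.1#
        h-leading = leading-descend ιh≋ (conjugates-leading (suc k) z)
        g∣h : g KFP.∣ h
        g∣h = g∣annihilator h (trans (Eval.⟦⟧-cong z ιh≋) (conjugates-root k z))

      -- The product of X minus the conjugates over a full period descends to K and vanishes at `z`,
      -- so `g` divides it.
      degree≤period : d ℕ.≤ suc k
      degree≤period = KFP.∣⇒≤ g h g∣h l≉0 g-leading K.1≉0 h-leading

      -- When the period equals the degree, the descended product `h` is monic of the same degree as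
      -- its divisor `g`, so g = l h; evaluating at a point of K turns `h` into a norm.
      norm-formula′ : d ≡ suc k → ∀ a → ι l * norm d (ι a - z) ≈ ι (K.eval g a)
      norm-formula′ d≡ a = begin
        ι l * norm d (ι a - z)                   ≈⟨ *-congˡ (reflexive (≡.cong (λ j → norm j (ι a - z)) d≡)) ⟩
        ι l * norm (suc k) (ι a - z)             ≈⟨ *-congˡ (conjugates-eval (suc k) z a) ⟨
        ι l * eval (conjugates (suc k) z) (ι a)  ≈⟨ *-congˡ (trans (Eval.⟦⟧-cong (ι a) (P.sym ιh≋)) (evalι-ι h a)) ⟩
        ι l * ι (K.eval h a)                     ≈⟨ ι.*-homo _ _ ⟨
        ι (l K.* K.eval h a)                     ≈⟨ ι.⟦⟧-cong lh≈g ⟩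
        ι (K.eval g a)                           ∎
        where
        module KE[a] = HomProperties KP.polynomialRing K.commutativeRing (EvalHom.eval-hom K.commutativeRing a)
        associated : ∃[ b ] b K.* l K.≈ K.1# × KP.const b KP.⊗ g KP.≋ h
        associated = KFP.∣∧degree≡⇒associated g h g∣h l≉0 g-leading K.1≉0
          (≡.subst (λ j → KD.Leading h j K.1#) (≡.sym d≡) h-leading)
        b = proj₁ associated
        h≈bg : K.eval h a K.≈ b K.* K.eval g a
        h≈bg = K.trans (KE[a].⟦⟧-cong (K[x].sym (proj₂ (proj₂ associated))))
          (K.trans (KE[a].*-homo (KP.const b) g) (K.*-congʳ (EvalHom.eval-const K.commutativeRing a b)))
        lh≈g : l K.* K.eval h a K.≈ K.eval g a
        lh≈g = K.trans (K.*-congˡ h≈bg) (K.trans (K.sym (K.*-assoc _ _ _))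
          (K.trans (K.*-congʳ (K.trans (K.*-comm l b) (proj₁ (proj₂ associated)))) (K.*-identityˡ _)))

    private
      conjugate : Fin (suc d) → Carrier
      conjugate i = φ^ (toℕ i) z

      collision? : Dec (∃[ i ] ∃[ j ] ¬ i ≡ j × conjugate i ≈ conjugate j)
      collision? = Fin.any? λ i → Fin.any? λ j → ¬? (i Fin.≟ j) ×-dec conjugate i ≟ conjugate j

      -- Injectivity of φ turns the coincidence into the period j - i, which is at most d. Periods
      -- are at least d by `degree≤period`, so j - i is d.
      period-from : ∀ {i j} → i ℕ.< j → j ℕ.≤ d → φ^ i z ≈ φ^ j z → φ^ d z ≈ z
      period-from {i} {j} i<j j≤d p = ≡.subst (λ k → φ^ k z ≈ z) (≡.sym d≡) φ^k
        where
        k = j ℕ.∸ suc i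
        i+k≡j : i ℕ.+ suc k ≡ j
        i+k≡j = ≡.trans (ℕ.+-suc i k) (ℕ.m+[n∸m]≡n i<j)
        φ^k : φ^ (suc k) z ≈ z
        φ^k = φ^-injective i (trans (reflexive (≡.trans (≡.sym (φ^-+ i (suc k) z)) (≡.cong (λ m → φ^ m z) i+k≡j)))
            (sym p))
        d≡ : d ≡ suc k
        d≡ = ℕ.≤-antisym (degree≤period φ^k)
          (ℕ.≤-trans (ℕ.m≤n+m (suc k) i) (ℕ.≤-trans (ℕ.≤-reflexive i+k≡j) j≤d))

    -- The d + 1 elements z, φ z, ..., φ^ d z are roots of g, so two of them coincide.
    period : φ^ d z ≈ z
    period with collision?
    ... | no distinct = contradiction (ι-injective (begin
      ι l               ≈⟨ ι.⟦⟧-cong (KD.lead g-leading) ⟨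
      ι (K.coeff g d)   ≈⟨ coeff-ι g d ⟨
      coeff (map ι g) d ≈⟨ roots-bound (suc d) conjugate injective (map ι g) g-below roots d ⟩
      0#                ≈⟨ ι.0#-homo ⟨
      ι K.0#            ∎)) l≉0
      where
      injective : ∀ {i j} → conjugate i ≈ conjugate j → i ≡ j
      injective {i} {j} p with i Fin.≟ j
      ... | yes i≡j = i≡j
      ... | no  i≢j = contradiction (i , j , i≢j , p) distinct
      g-below : Below (suc d) (map ι g)
      g-below k d<k = trans (coeff-ι g k) (trans (ι.⟦⟧-cong (KD.below g-leading k d<k)) ι.0#-homo)
      roots : ∀ i → eval (map ι g) (conjugate i) ≈ 0#
      roots i = trans (evalι-φ^ (toℕ i) g z) (trans (φ^-cong (toℕ i) g[z]≈0) (φ^.0#-homo (toℕ i)))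
    ... | yes (i , j , i≢j , p) with ℕ.<-cmp (toℕ i) (toℕ j)
    ...   | tri< i<j _ _ = period-from i<j (Fin.toℕ≤pred[n] j) p
    ...   | tri≈ _ i≡j _ = contradiction (Fin.toℕ-injective i≡j) i≢j
    ...   | tri> _ _ j<i = period-from j<i (Fin.toℕ≤pred[n] i) (sym p)

    norm-formula : 1 ℕ.≤ d → ∀ a → ι l * norm d (ι a - z) ≈ ι (K.eval g a)
    norm-formula 1≤d = norm-formula′ {k} (≡.subst (λ j → φ^ j z ≈ z) (≡.sym suc-k≡d) period) (≡.sym suc-k≡d)
      where
      k = ℕ.pred d
      suc-k≡d : suc k ≡ d
      suc-k≡d = ℕ.suc-pred d {{ℕ.>-nonZero 1≤d}}

-- Roots of unity of prime order and the Kummer step.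

module RootsOfUnity {c ℓ} (F : DiscreteField c ℓ) where
  open DiscreteField F hiding (zero)
  open FieldProperties F
  open Exp commutativeSemiring
  open import Relation.Binary.Reasoning.Setoid setoid

  ^-multiple : ∀ {x m} k → x ^ m ≈ 1# → x ^ (k ℕ.* m) ≈ 1#
  ^-multiple {x} {m} k x^m≈1 = begin
    x ^ (k ℕ.* m)   ≈⟨ ^-congʳ x (ℕ.*-comm k m) ⟩
    x ^ (m ℕ.* k)   ≈⟨ ^-assocʳ x m k ⟨
    (x ^ m) ^ k     ≈⟨ ^-congˡ k x^m≈1 ⟩
    1# ^ k          ≈⟨ 1^n≈1 k ⟩
    1#              ∎

  -- A nonzero remainder of t modulo r is coprime to r, and Bézout would then write x itself as a
  -- quotient of powers that equal 1. The two constructors are the two signs of the Bézout identity.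
  prime-order : ∀ {r x} → Prime r → x ^ r ≈ 1# → ¬ x ≈ 1# → ∀ t → x ^ t ≈ 1# → r ℕ.∣ t
  prime-order {r} {x} r-prime x^r≈1 x≉1 t x^t≈1 = ℕ.m%n≡0⇒n∣m t r (remainder≡0 (t % r) (m%n<n t r) x^[t%r]≈1)
    where
    instance _ = prime⇒nonZero r-prime
    x^[t%r]≈1 : x ^ (t % r) ≈ 1#
    x^[t%r]≈1 = begin
      x ^ (t % r)                             ≈⟨ *-identityʳ _ ⟨
      x ^ (t % r) * 1#                        ≈⟨ *-congˡ (^-multiple (t / r) x^r≈1) ⟨
      x ^ (t % r) * x ^ (t / r ℕ.* r)         ≈⟨ ^-homo-* x (t % r) (t / r ℕ.* r) ⟨
      x ^ (t % r ℕ.+ t / r ℕ.* r)             ≈⟨ ^-congʳ x (≡.sym (m≡m%n+[m/n]*n t r)) ⟩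
      x ^ t                                   ≈⟨ x^t≈1 ⟩
      1#                                      ∎
    x≈1 : ∀ {i j} → x ^ i ≈ 1# → x ^ j ≈ 1# → ∀ u v → 1 ℕ.+ v ℕ.* j ≡ u ℕ.* i → x ≈ 1#
    x≈1 {i} {j} x^i≈1 x^j≈1 u v eq = begin
      x                      ≈⟨ *-identityʳ x ⟨
      x * 1#                 ≈⟨ *-congˡ (^-multiple v x^j≈1) ⟨
      x * x ^ (v ℕ.* j)      ≈⟨ ^-congʳ x eq ⟩
      x ^ (u ℕ.* i)          ≈⟨ ^-multiple u x^i≈1 ⟩
      1#                     ∎
    remainder≡0 : ∀ s → s ℕ.< r → x ^ s ≈ 1# → s ≡ 0
    remainder≡0 zero    _   _     = ≡.refl
    remainder≡0 (suc s) s<r x^s≈1 with coprime-Bézout (prime⇒coprime r-prime s<r)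
    ... | Bézout.+- u v eq = contradiction (x≈1 x^r≈1 x^s≈1 u v eq) x≉1
    ... | Bézout.-+ u v eq = contradiction (x≈1 x^s≈1 x^r≈1 v u eq) x≉1

-- One step of the tower: z is a root of g and e - z = - a w ^ r.
module Kummer {c ℓ c′ ℓ′ n} (𝕂 : FiniteField (2 ℕ.+ n) c ℓ) (𝕄 : DiscreteField c′ ℓ′)
  {ι : FiniteField.Carrier 𝕂 → DiscreteField.Carrier 𝕄}
  (ι-hom : IsRingHomomorphism (FiniteField.commutativeRing 𝕂) (DiscreteField.commutativeRing 𝕄) ι)
  where
  private
    module K = FiniteField 𝕂
    module KF = Finite 𝕂
    module Kf = FieldProperties KF.discreteField
    module KE = Exp K.commutativeSemiring
    module KFP = FieldPolynomials KF.discreteField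
    module KD = Degree K.commutativeRing
    module ι = HomProperties K.commutativeRing (DiscreteField.commutativeRing 𝕄) ι-hom
  open DiscreteField 𝕄 hiding (zero)
  open FieldProperties 𝕄
  open Exp commutativeSemiring
  open Frobenius 𝕂 𝕄 ι-hom
  open import Relation.Binary.Reasoning.Setoid setoid

  φ^-multiple : ∀ {d z} → φ^ d z ≈ z → ∀ t → φ^ (t ℕ.* d) z ≈ z
  φ^-multiple         p zero    = refl
  φ^-multiple {d} {z} p (suc t) = trans (reflexive (φ^-+ d (t ℕ.* d) z)) (trans (φ^-cong d (φ^-multiple p t)) p)

  -- The eigenvalue lies in K and so is fixed by `φ^ d`; every further application contributes one
  -- more factor ζ.
  φ^-eigen : ∀ {d z ζ} → φ^ d z ≈ ι ζ * z → ∀ t → φ^ (t ℕ.* d) z ≈ ι (ζ KE.^ t) * z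
  φ^-eigen {d} {z} {ζ} p zero    = sym (trans (*-congʳ ι.1#-homo) (*-identityˡ z))
  φ^-eigen {d} {z} {ζ} p (suc t) = begin
    φ^ (d ℕ.+ t ℕ.* d) z                  ≡⟨ φ^-+ d (t ℕ.* d) z ⟩
    φ^ d (φ^ (t ℕ.* d) z)                 ≈⟨ φ^-cong d (φ^-eigen p t) ⟩
    φ^ d (ι (ζ KE.^ t) * z)               ≈⟨ φ^.*-homo d _ _ ⟩
    φ^ d (ι (ζ KE.^ t)) * φ^ d z          ≈⟨ *-cong (φ^-ι d _) p ⟩
    ι (ζ KE.^ t) * (ι ζ * z)              ≈⟨ *-assoc _ _ _ ⟨
    ι (ζ KE.^ t) * ι ζ * z                ≈⟨ *-congʳ (trans (*-comm _ _) (sym (ι.*-homo _ _))) ⟩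
    ι (ζ KE.^ suc t) * z                  ∎

  module Step {g d l} (g-irreducible : KFP.Irreducible g) (l≉0 : ¬ l K.≈ K.0#)
    (g-leading : KD.Leading g d l) (1≤d : 1 ℕ.≤ d) {z : Carrier} (g[z]≈0 : evalι g z ≈ 0#) (w : Carrier)
    {r k : ℕ} (r-prime : Prime r) (rk≡q-1 : r ℕ.* k ≡ suc n) {a e b : K.Carrier} (a≉0 : ¬ a K.≈ K.0#)
    (e-z≈ : ι e - z ≈ ι (K.- a) * w ^ r) (b-def : l K.* (K.- a) KE.^ d K.* b K.≈ K.eval g e) where

    private
      module R = Root g-irreducible l≉0 g-leading g[z]≈0
      ν = norm d w
      s = l K.* (K.- a) KE.^ d

      -a≉0 : ¬ K.- a K.≈ K.0#
      -a≉0 p = a≉0 (K.trans (K.sym (-‿involutive a)) (K.trans (K.-‿cong p) -0#≈0#))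
        where open Algebra.Properties.Ring K.ring

      s≉0 : ¬ ι s ≈ 0#
      s≉0 p = Kf.x*y≉0 l≉0 (Kf.x^n≉0 d -a≉0) (ι-injective (trans p (sym ι.0#-homo)))

    b≈norm^r : ι b ≈ norm d w ^ r
    b≈norm^r = *-cancelˡ _ _ s≉0 (begin
      ι s * ι b                                   ≈⟨ ι.*-homo _ _ ⟨
      ι (s K.* b)                                 ≈⟨ ι.⟦⟧-cong b-def ⟩
      ι (K.eval g e)                              ≈⟨ R.norm-formula 1≤d e ⟨
      ι l * norm d (ι e - z)                      ≈⟨ *-congˡ (norm-cong d e-z≈) ⟩
      ι l * norm d (ι (K.- a) * w ^ r)
          ≈⟨ *-congˡ (trans (norm-* d _ _) (*-cong (norm-ι d _) (norm-^ d w r))) ⟩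
      ι l * (ι ((K.- a) KE.^ d) * ν ^ r)          ≈⟨ *-assoc _ _ _ ⟨
      ι l * ι ((K.- a) KE.^ d) * ν ^ r            ≈⟨ *-congʳ (ι.*-homo _ _) ⟨
      ι s * ν ^ r                                 ∎)

    frobenius-w : φ^ d w ≈ ι (b KE.^ k) * w
    frobenius-w = trans (φ^≈norm^*id d w) (*-congʳ (begin
      ν ^ suc n          ≈⟨ ^-congʳ ν rk≡q-1 ⟨
      ν ^ (r ℕ.* k)      ≈⟨ ^-assocʳ ν r k ⟨
      (ν ^ r) ^ k        ≈⟨ ^-congˡ k b≈norm^r ⟨
      ι b ^ k            ≈⟨ ι.^-homo b k ⟨
      ι (b KE.^ k)       ∎))

    b≈0⇒w≈0 : b K.≈ K.0# → w ≈ 0#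
    b≈0⇒w≈0 b≈0 = norm≈0⇒≈0 d w (x^n≈0⇒x≈0 ν r (trans (sym b≈norm^r) (trans (ι.⟦⟧-cong b≈0) ι.0#-homo)))

    -- For y nonzero, b ^ k = y ^ (q - 1) = 1 by Fermat. For y = 0 that fails, but then the norm of
    -- `w` is zero, so `w` is zero and trivially fixed.
    power⇒fixed : ∀ {y} → b K.≈ y KE.^ r → φ^ d w ≈ w
    power⇒fixed {y} b≈y^r with DiscreteField._≟_ KF.discreteField y K.0#
    ... | no y≉0 = trans frobenius-w (trans (*-congʳ (trans (ι.⟦⟧-cong b^k≈1) ι.1#-homo)) (*-identityˡ w))
      where
      b^k≈1 : b KE.^ k K.≈ K.1#
      b^k≈1 = K.trans (KE.^-congˡ k b≈y^r) (K.trans (KE.^-assocʳ y r k)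
        (K.trans (KE.^-congʳ y rk≡q-1) (KF.fermat-unit y y≉0)))
    ... | yes y≈0 = trans (φ^-cong d w≈0) (trans (φ^.0#-homo d) (sym w≈0))
      where
      b≈0 : b K.≈ K.0#
      b≈0 = K.trans b≈y^r (K.trans (KE.^-congˡ r y≈0)
        (K.trans (KE.^-congʳ K.0# (≡.sym (ℕ.suc-pred r {{prime⇒nonZero r-prime}}))) (K.zeroˡ _)))
      w≈0 : w ≈ 0#
      w≈0 = b≈0⇒w≈0 b≈0

    -- First m = t d, because a nonzero remainder modulo d would be a period of `z` shorter than the
    -- degree d. Then w = φ ^ m w = ζ ^ t w, and `w` can be cancelled since b, not being 0 ^ r, is
    -- nonzero. This leaves ζ ^ t = 1 with ζ of order r.
    nonpower⇒long-period : ¬ (∃[ y ] b K.≈ y KE.^ r) → ∀ {m} → 1 ℕ.≤ m → φ^ m z ≈ z → φ^ m w ≈ w → d ℕ.* r ℕ.≤ m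
    nonpower⇒long-period b-nonpower {m} 1≤m φᵐz≈z φᵐw≈w = bound (prime-order r-prime ζ^r≈1 ζ≉1 t ζ^t≈1)
      where
      open RootsOfUnity KF.discreteField
      instance
        _ = ℕ.>-nonZero 1≤d
        _ = prime⇒nonZero r-prime
      t = m / d
      m≡ : m ≡ m % d ℕ.+ t ℕ.* d
      m≡ = m≡m%n+[m/n]*n m d
      remainder-period : φ^ (m % d) z ≈ z
      remainder-period = begin
        φ^ (m % d) z                    ≈⟨ φ^-cong (m % d) (φ^-multiple R.period t) ⟨
        φ^ (m % d) (φ^ (t ℕ.* d) z)     ≡⟨ φ^-+ (m % d) (t ℕ.* d) z ⟨
        φ^ (m % d ℕ.+ t ℕ.* d) z        ≡⟨ ≡.cong (λ i → φ^ i z) m≡ ⟨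
        φ^ m z                          ≈⟨ φᵐz≈z ⟩
        z                               ∎
      remainder≡0 : ∀ i → i ℕ.< d → φ^ i z ≈ z → i ≡ 0
      remainder≡0 zero    _   _ = ≡.refl
      remainder≡0 (suc i) i<d p = contradiction (R.degree≤period p) (ℕ.<⇒≱ i<d)
      m≡td : m ≡ t ℕ.* d
      m≡td = ≡.trans m≡ (≡.cong (ℕ._+ t ℕ.* d) (remainder≡0 (m % d) (m%n<n m d) remainder-period))
      b≉0 : ¬ b K.≈ K.0#
      b≉0 b≈0 = b-nonpower (K.0# , K.trans b≈0 (K.trans (K.sym (K.zeroˡ _))
        (KE.^-congʳ K.0# (ℕ.suc-pred r))))
      w≉0 : ¬ w ≈ 0#
      w≉0 w≈0 = b≉0 (ι-injective (begin
        ι b              ≈⟨ b≈norm^r ⟩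
        norm d w ^ r     ≈⟨ ^-congˡ r norm≈0 ⟩
        0# ^ r           ≈⟨ ^-congʳ 0# (ℕ.suc-pred r) ⟨
        0# ^ suc (ℕ.pred r) ≈⟨ zeroˡ _ ⟩
        0#               ≈⟨ ι.0#-homo ⟨
        ι K.0#           ∎))
        where
        norm≈0 : norm d w ≈ 0#
        norm≈0 = trans (reflexive (≡.cong (λ i → norm i w) (≡.sym (ℕ.suc-pred d))))
          (trans (*-congˡ (trans (φ^-cong (ℕ.pred d) w≈0) (φ^.0#-homo (ℕ.pred d)))) (zeroʳ _))
      ζ = b KE.^ k
      ζ^r≈1 : ζ KE.^ r K.≈ K.1#
      ζ^r≈1 = K.trans (KE.^-assocʳ b k r)
        (K.trans (KE.^-congʳ b (≡.trans (ℕ.*-comm k r) rk≡q-1)) (KF.fermat-unit b b≉0))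
      -- The hypothesis on `b` enters here: ζ is b ^ ((q - 1) / r), and the value 1 would make `b`
      -- an r-th power.
      ζ≉1 : ¬ ζ K.≈ K.1#
      ζ≉1 ζ≈1 = b-nonpower (KF.power-criterion r k b rk≡q-1 (s≤s z≤n) ζ≈1)
      ζ^t≈1 : ζ KE.^ t K.≈ K.1#
      ζ^t≈1 = ι-injective (*-cancelˡ _ _ w≉0 (begin
        w * ι (ζ KE.^ t)    ≈⟨ *-comm _ _ ⟩
        ι (ζ KE.^ t) * w    ≈⟨ φ^-eigen frobenius-w t ⟨
        φ^ (t ℕ.* d) w      ≡⟨ ≡.cong (λ i → φ^ i w) m≡td ⟨
        φ^ m w              ≈⟨ φᵐw≈w ⟩
        w                   ≈⟨ trans (*-congˡ ι.1#-homo) (*-identityʳ w) ⟨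
        w * ι K.1#          ∎))
      bound : r ℕ.∣ t → d ℕ.* r ℕ.≤ m
      -- Divisibility gives an inequality only for positive t; t = 0 would give m = 0.
      bound (divides zero    t≡0) = contradiction
        (≡.subst (1 ℕ.≤_) (≡.trans m≡td (≡.cong (ℕ._* d) t≡0)) 1≤m) λ ()
      bound (divides (suc j) t≡) = ℕ.≤-trans (ℕ.≤-reflexive (ℕ.*-comm d r)) (ℕ.≤-trans
        (ℕ.*-monoˡ-≤ d (ℕ.≤-trans (ℕ.m≤m+n r (j ℕ.* r)) (ℕ.≤-reflexive (≡.sym t≡)))) (ℕ.≤-reflexive (≡.sym m≡td)))

-- Composition of polynomials.

module Composite {c ℓ} (R : CommutativeRing c ℓ) where
  open CommutativeRing R hiding (zero)
  open Polynomial R using (_∘ₚ_; _+ₚ_; _*ₚ_; eval)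
  open PolynomialRing R
  open Degree R
  open EvalHom R
  private
    module P = CommutativeRing polynomialRing
    module Eval x = HomProperties polynomialRing R (eval-hom x)
  open import Relation.Binary.Reasoning.Setoid P.setoid

  ∷-∘ : ∀ a f g → (a ∷ f) ∘ₚ g ≡ const a ⊕ g ⊗ (f ∘ₚ g)
  ∷-∘ a f g = ≡.sym (≡.trans (⊕≡+ₚ _ _) (≡.cong (const a +ₚ_) (⊗≡*ₚ _ _)))

  private
    -- Composition is evaluation at `g` over the polynomial ring once coefficients are read as
    -- constants. The homomorphism laws for composition are then inherited from those of `map` and
    -- `eval`.
    ∘≡eval : ∀ f g → f ∘ₚ g ≡ Polynomial.eval polynomialRing (map const f) g
    ∘≡eval []      g = ≡.refl
    ∘≡eval (a ∷ f) g = ≡.trans (∷-∘ a f g) (≡.cong (λ h → const a ⊕ g ⊗ h) (∘≡eval f g))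

  ∘-hom : ∀ g → IsRingHomomorphism polynomialRing polynomialRing (_∘ₚ g)
  ∘-hom g = ringHomomorphism polynomialRing polynomialRing
    (λ {f} {h} p → P.trans (∘≋ f) (P.trans (E.⟦⟧-cong (M.⟦⟧-cong p)) (P.sym (∘≋ h))))
    (λ f h → P.trans (∘≋ (f ⊕ h)) (P.trans (E.⟦⟧-cong (M.+-homo f h))
        (P.trans (E.+-homo _ _) (P.sym (P.+-cong (∘≋ f) (∘≋ h))))))
    (λ f h → P.trans (∘≋ (f ⊗ h)) (P.trans (E.⟦⟧-cong (M.*-homo f h))
        (P.trans (E.*-homo _ _) (P.sym (P.*-cong (∘≋ f) (∘≋ h))))))
    (P.trans (∘≋ P.1#) (P.trans (E.⟦⟧-cong M.1#-homo) E.1#-homo))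
    where
    module M = HomProperties polynomialRing (PolynomialRing.polynomialRing polynomialRing)
      (MapHom.map-hom R polynomialRing const-hom)
    module E = HomProperties (PolynomialRing.polynomialRing polynomialRing) polynomialRing
      (EvalHom.eval-hom polynomialRing g)
    ∘≋ : ∀ f → f ∘ₚ g ≋ Polynomial.eval polynomialRing (map const f) g
    ∘≋ f = P.reflexive (∘≡eval f g)
  module _∘ g = HomProperties polynomialRing polynomialRing (∘-hom g)

  const-∘ : ∀ a g → const a ∘ₚ g ≋ const a
  const-∘ a g = P.trans (P.reflexive (∷-∘ a [] g)) (P.trans (P.+-congˡ (P.zeroʳ g)) (P.+-identityʳ _))

  X-∘ : ∀ g → X ∘ₚ g ≋ g
  X-∘ g = begin
    X ∘ₚ g                           ≡⟨ ∷-∘ 0# (const 1#) g ⟩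
    const 0# ⊕ g ⊗ (const 1# ∘ₚ g)   ≈⟨ P.+-cong C.0#-homo (P.trans (P.*-congˡ (const-∘ 1# g)) (P.*-identityʳ g)) ⟩
    [] ⊕ g                           ≈⟨ P.+-identityˡ g ⟩
    g                                ∎
    where module C = HomProperties R polynomialRing const-hom

  ∘-X : ∀ f → f ∘ₚ X ≋ f
  ∘-X []      = P.refl
  ∘-X (a ∷ f) = begin
    (a ∷ f) ∘ₚ X               ≡⟨ ∷-∘ a f X ⟩
    const a ⊕ X ⊗ (f ∘ₚ X)     ≈⟨ P.+-congˡ (P.*-congˡ (∘-X f)) ⟩
    const a ⊕ X ⊗ f            ≈⟨ ∷≋ a f ⟨
    a ∷ f                      ∎

  ∘-congʳ : ∀ f {g h} → g ≋ h → f ∘ₚ g ≋ f ∘ₚ h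
  ∘-congʳ []      p = P.refl
  ∘-congʳ (a ∷ f) {g} {h} p = begin
    (a ∷ f) ∘ₚ g               ≡⟨ ∷-∘ a f g ⟩
    const a ⊕ g ⊗ (f ∘ₚ g)     ≈⟨ P.+-congˡ (P.*-cong p (∘-congʳ f p)) ⟩
    const a ⊕ h ⊗ (f ∘ₚ h)     ≡⟨ ∷-∘ a f h ⟨
    (a ∷ f) ∘ₚ h               ∎

  ∘-assoc : ∀ f g h → (f ∘ₚ g) ∘ₚ h ≋ f ∘ₚ (g ∘ₚ h)
  ∘-assoc []      g h = P.refl
  ∘-assoc (a ∷ f) g h = begin
    ((a ∷ f) ∘ₚ g) ∘ₚ h                        ≡⟨ ≡.cong (_∘ₚ h) (∷-∘ a f g) ⟩
    (const a ⊕ g ⊗ (f ∘ₚ g)) ∘ₚ h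
        ≈⟨ P.trans (H.+-homo _ _) (P.+-cong (const-∘ a h) (H.*-homo g (f ∘ₚ g))) ⟩
    const a ⊕ (g ∘ₚ h) ⊗ ((f ∘ₚ g) ∘ₚ h)       ≈⟨ P.+-congˡ (P.*-congˡ (∘-assoc f g h)) ⟩
    const a ⊕ (g ∘ₚ h) ⊗ (f ∘ₚ (g ∘ₚ h))       ≡⟨ ∷-∘ a f (g ∘ₚ h) ⟨
    (a ∷ f) ∘ₚ (g ∘ₚ h)                        ∎
    where module H = _∘ h

  eval-∘ : ∀ f g x → eval (f ∘ₚ g) x ≈ eval f (eval g x)
  eval-∘ []      g x = refl
  eval-∘ (a ∷ f) g x = trans (reflexive (≡.cong (λ h → eval h x) (∷-∘ a f g)))
    (trans (Eval.+-homo x (const a) _) (+-cong (eval-const x a)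
      (trans (Eval.*-homo x g (f ∘ₚ g)) (*-congˡ (eval-∘ f g x)))))

-- The tower of iterates.

module Iterates {c ℓ n} (𝕂 : FiniteField (2 ℕ.+ n) c ℓ) where
  private
    module KF = Finite 𝕂
  open FiniteField 𝕂 hiding (zero; Poly; coeff; const; X; Irreducible)
  open PolynomialRing commutativeRing
  open Degree commutativeRing
  open Composite commutativeRing
  open EvalHom commutativeRing
  open FieldProperties KF.discreteField
  open FieldPolynomials KF.discreteField
    using (no-small-factor⇒irreducible; leading-0⇒∣1; factors-leading; ∤1; module Residue; Irreducible; mkIrred; _∣_;
        _,_)
  private
    module P = CommutativeRing polynomialRing
    module Eval x = HomProperties polynomialRing commutativeRing (eval-hom x)
    module const = HomProperties commutativeRing polynomialRing const-hom
  open Exp commutativeSemiring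
  open Exp P.commutativeSemiring using () renaming (_^_ to _^ᵖ_; ^-congˡ to ^ᵖ-congˡ)

  -- Start of the induction: the zeroth iterate is `X`, so the irreducibility of `f` itself is
  -- already an instance of the general step.
  X-irreducible : Irreducible X
  X-irreducible = mkIrred (∤1 X 1≉0 leading-X (s≤s z≤n)) split
    where
    split : ∀ {f g} → X ≋ f ⊗ g → f ∣ P.1# ⊎ g ∣ P.1#
    split {f} {g} X≋fg with factors-leading f g X (P.sym X≋fg) 1≉0 leading-X
    ... | zero  , _ , _ , _ , b≉0 , _ , lf , _ = inj₁ (leading-0⇒∣1 b≉0 lf)
    ... | suc zero , zero , _ , _ , _ , c≉0 , _ , lg , _ = inj₂ (leading-0⇒∣1 c≉0 lg)

  module Tower {r k : ℕ} (r-prime : Prime r) (rk≡q-1 : r ℕ.* k ≡ suc n) (f : Poly) {a : Carrier} (γ e : Carrier)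
    (a≉0 : ¬ a ≈ 0#) (form : f ≋ const a ⊗ (X ⊕ const (- γ)) ^ᵖ r ⊕ const e) where

    private
      instance
        _ = prime⇒nonZero r-prime
      2≤r : 2 ℕ.≤ r
      2≤r = ℕ.nonTrivial⇒n>1 r {{prime⇒nonTrivial r-prime}}

      w : Poly
      w = X ⊕ const (- γ)

    1≤r^ : ∀ i → 1 ℕ.≤ r ℕ.^ i
    1≤r^ i = ℕ.m^n>0 r i

    iterate-suc : ∀ i → iterate f (suc i) ≋ const a ⊗ (iterate f i ⊕ const (- γ)) ^ᵖ r ⊕ const e
    iterate-suc i = P.trans (C.⟦⟧-cong form) (P.trans (C.+-homo _ _) (P.+-cong
      (P.trans (C.*-homo _ _) (P.*-cong (const-∘ a g) (P.trans (C.^-homo w r)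
        (^ᵖ-congˡ r (P.trans (C.+-homo _ _) (P.+-cong (X-∘ g) (const-∘ (- γ) g)))))))
      (const-∘ e g)))
      where
      g = iterate f i
      module C = _∘ g

    leadingCoeff : ℕ → Carrier
    leadingCoeff zero    = 1#
    leadingCoeff (suc i) = a * leadingCoeff i ^ r

    leadingCoeff≉0 : ∀ i → ¬ leadingCoeff i ≈ 0#
    leadingCoeff≉0 zero    = 1≉0
    leadingCoeff≉0 (suc i) = x*y≉0 a≉0 (x^n≉0 r (leadingCoeff≉0 i))

    iterate-leading : ∀ i → Leading (iterate f i) (r ℕ.^ i) (leadingCoeff i)
    iterate-leading zero    = leading-X
    iterate-leading (suc i) = leading-cong (P.sym (iterate-suc i)) refl
      (leading-⊕ _ (const e)
        (leading-⊗ (const a) _ (leading-const a)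
          (leading-^ _ (leading-⊕ (iterate f i) (const (- γ)) (iterate-leading i)
            (below-mono (const (- γ)) (1≤r^ i) (below-const _))) r))
        (below-mono (const e) (1≤r^ (suc i)) (below-const e)))

    -- `iterate` adds `f` on the outside, whereas the field argument needs it on the inside, where
    -- the class of `f` becomes a root of the previous iterate.
    iterate-comm : ∀ i → iterate f i ∘ₚ f ≋ iterate f (suc i)
    iterate-comm zero    = P.trans (X-∘ f) (P.sym (∘-X f))
    iterate-comm (suc i) = P.trans (∘-assoc f (iterate f i) f) (∘-congʳ f (iterate-comm i))

    module Extension (i : ℕ) (g-irreducible : Irreducible (iterate f i)) {b : Carrier}
      (b-def : leadingCoeff i * (- a) ^ (r ℕ.^ i) * b ≈ eval (iterate f i) e)
      {p : Poly} (p-irreducible : Irreducible p) (p∣ : p ∣ iterate f (suc i)) where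
      private
        d = r ℕ.^ i
        𝕄 = Residue.residueField p-irreducible
        module 𝕄 = DiscreteField 𝕄
        open QuotientRing polynomialRing p
        open IntegerSolver polynomialRing
        module 𝕄E = Exp 𝕄.commutativeSemiring

        ι-hom : IsRingHomomorphism commutativeRing 𝕄.commutativeRing const
        ι-hom = ringHomomorphism commutativeRing 𝕄.commutativeRing (λ p → ≈⇒≈ₘ (const-cong p))
          (λ x y → ≈⇒≈ₘ (const.+-homo x y)) (λ x y → ≈⇒≈ₘ (const.*-homo x y)) (≈⇒≈ₘ P.refl)

        open Frobenius 𝕂 𝕄 ι-hom
        open Kummer 𝕂 𝕄 ι-hom

        evalι≡∘ : ∀ h z → evalι h z ≡ h ∘ₚ z
        evalι≡∘ []      z = ≡.refl
        evalι≡∘ (x ∷ h) z = ≡.trans (≡.cong (λ u → const x ⊕ z ⊗ u) (evalι≡∘ h z)) (≡.sym (∷-∘ x h z))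

        ^≡^ᵖ : ∀ x j → x 𝕄E.^ j ≡ x ^ᵖ j
        ^≡^ᵖ x zero    = ≡.refl
        ^≡^ᵖ x (suc j) = ≡.cong (x ⊗_) (^≡^ᵖ x j)

        -- The residue field is used with two roots: `f` for the previous iterate, and `X` for `p`.
        -- The second one ties the degree of `p` to the period of `X`.
        p[X]≈0 : evalι p X 𝕄.≈ 𝕄.0#
        p[X]≈0 = 𝕄.trans (𝕄.reflexive (evalι≡∘ p X)) (𝕄.trans (≈⇒≈ₘ (∘-X p)) (∣⇒≈ₘ0 (P.1# , P.*-identityˡ p)))

        g[f]≈0 : evalι (iterate f i) f 𝕄.≈ 𝕄.0#
        g[f]≈0 = 𝕄.trans (𝕄.reflexive (evalι≡∘ (iterate f i) f)) (𝕄.trans (≈⇒≈ₘ (iterate-comm i)) (∣⇒≈ₘ0 p∣))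

        e-f≈ : const e ⊕ neg f 𝕄.≈ const (- a) ⊗ w 𝕄E.^ r
        e-f≈ = 𝕄.trans (≈⇒≈ₘ (P.trans (P.+-congˡ (P.-‿cong form)) (P.trans
          (solve 3 (λ e a w → e :- (a :* w :+ e) := :- a :* w) P.refl (const e) (const a) (w ^ᵖ r))
          (P.*-congʳ (P.sym (const.-‿homo a)))))) (𝕄.reflexive (≡.cong (const (- a) ⊗_) (≡.sym (^≡^ᵖ w r))))

        module Step′ = Step g-irreducible (leadingCoeff≉0 i) (iterate-leading i) (1≤r^ i) g[f]≈0 w r-prime rk≡q-1 a≉0
            e-f≈ b-def

      power⇒degree≤ : ∀ {y m s} → b ≈ y ^ r → ¬ s ≈ 0# → Leading p m s → m ℕ.≤ d
      power⇒degree≤ {y} {m} b≈y^r s≉0 p-leading = ≡.subst (m ℕ.≤_) d≡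
        (Root.degree≤period p-irreducible s≉0 p-leading p[X]≈0 (≡.subst (λ j → φ^ j X 𝕄.≈ X) (≡.sym d≡) X-fixed))
        where
        d≡ : suc (ℕ.pred d) ≡ d
        d≡ = ℕ.suc-pred d {{ℕ.>-nonZero (1≤r^ i)}}
        w+γ≋X : w ⊕ const γ ≋ X
        w+γ≋X = P.trans (P.+-congʳ (P.+-congˡ (const.-‿homo γ)))
            (solve 2 (λ x γ → x :- γ :+ γ := x) P.refl X (const γ))
        -- Once `w` is fixed so is `X`, which is `w` plus the constant γ.
        X-fixed : φ^ d X 𝕄.≈ X
        X-fixed = 𝕄.trans (φ^-cong d (≈⇒≈ₘ (P.sym w+γ≋X))) (𝕄.trans (φ^.+-homo d w (const γ))
          (𝕄.trans (𝕄.+-cong (Step′.power⇒fixed b≈y^r) (φ^-ι d γ)) (≈⇒≈ₘ w+γ≋X)))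

      -- The degree m of `p` is a period of `X`, hence of `w` and of `f`, both of which are
      -- polynomials in `X` over K. So m is a common period as required by `nonpower⇒long-period`; m
      -- = 0 would make `p` a unit.
      nonpower⇒≤degree : ¬ b ∈ IsPower r → ∀ {m s} → ¬ s ≈ 0# → Leading p m s → d ℕ.* r ℕ.≤ m
      nonpower⇒≤degree b-nonpower {zero} s≉0 p-leading = contradiction (leading-0⇒∣1 s≉0 p-leading)
          (Irr.p∤1 p-irreducible)
        where module Irr = Irreducible
      nonpower⇒≤degree b-nonpower {m@(suc _)} s≉0 p-leading =
        Step′.nonpower⇒long-period b-nonpower (s≤s z≤n) f-fixed w-fixed
        where
        X-fixed : φ^ m X 𝕄.≈ X
        X-fixed = Root.period p-irreducible s≉0 p-leading p[X]≈0
        w-fixed : φ^ m w 𝕄.≈ w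
        w-fixed = 𝕄.trans (φ^.+-homo m X (const (- γ))) (𝕄.+-cong X-fixed (φ^-ι m (- γ)))
        f≈f[X] : f 𝕄.≈ evalι f X
        f≈f[X] = 𝕄.sym (𝕄.trans (𝕄.reflexive (evalι≡∘ f X)) (≈⇒≈ₘ (∘-X f)))
        f-fixed : φ^ m f 𝕄.≈ f
        f-fixed = 𝕄.trans (φ^-cong m f≈f[X]) (𝕄.trans (𝕄.sym (evalι-φ^ m f X))
          (𝕄.trans (𝕄.reflexive (evalι≡∘ f (φ^ m X))) (𝕄.trans (≈ₘ-∘ f X-fixed) (≈⇒≈ₘ (∘-X f)))))
          where
          ≈ₘ-∘ : ∀ h {x y} → x 𝕄.≈ y → h ∘ₚ x 𝕄.≈ h ∘ₚ y
          ≈ₘ-∘ []      p = 𝕄.refl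
          ≈ₘ-∘ (z ∷ h) {x} {y} p = 𝕄.trans (𝕄.reflexive (∷-∘ z h x)) (𝕄.trans
            (𝕄.+-congˡ (𝕄.*-cong p (≈ₘ-∘ h p))) (𝕄.reflexive (≡.sym (∷-∘ z h y))))

    -- Indexed so that `orbit i` governs the passage from the i-th to the (i + 1)-st iterate; the
    -- condition n > 1 becomes the shift by 2.
    orbit : ℕ → Carrier
    orbit zero    = divide (- eval f γ) a a≉0
    orbit (suc i) = divide (eval (iterate f (2 ℕ.+ i)) γ) a a≉0

    private
      a⁻¹ = proj₁ (invertible a a≉0)
      a⁻¹a≈1 = proj₁ (proj₂ (invertible a a≉0))
      open IntegerSolver commutativeRing

    eval-critical : eval f γ ≈ e
    eval-critical = begin
      eval f γ                                    ≈⟨ E.⟦⟧-cong form ⟩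
      eval (const a ⊗ w ^ᵖ r ⊕ const e) γ         ≈⟨ trans (E.+-homo _ _) (+-cong (E.*-homo _ _) (eval-const γ e)) ⟩
      eval (const a) γ * eval (w ^ᵖ r) γ + e
          ≈⟨ +-congʳ (*-congˡ (trans (E.^-homo w r) (trans (^-congˡ r w≈0) 0^r≈0))) ⟩
      eval (const a) γ * 0# + e                   ≈⟨ trans (+-congʳ (zeroʳ _)) (+-identityˡ e) ⟩
      e                                           ∎
      where
      open import Relation.Binary.Reasoning.Setoid setoid
      module E = Eval γ
      w≈0 : eval w γ ≈ 0#
      w≈0 = trans (E.+-homo X (const (- γ))) (trans (+-cong (eval-X γ) (eval-const γ (- γ))) (-‿inverseʳ γ))
      0^r≈0 : 0# ^ r ≈ 0#
      0^r≈0 = trans (^-congʳ 0# (≡.sym (ℕ.suc-pred r))) (zeroˡ _)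

    -- The constant `e` is the critical value f(γ), so the critical orbit is entered one iterate
    -- later.
    eval-iterate : ∀ i → eval (iterate f i) e ≈ eval (iterate f (suc i)) γ
    eval-iterate i = trans (eval-cong-point (iterate f i) (sym eval-critical))
      (trans (sym (eval-∘ (iterate f i) f γ)) (Eval.⟦⟧-cong γ (iterate-comm i)))
      where
      eval-cong-point : ∀ h {x y} → x ≈ y → eval h x ≈ eval h y
      eval-cong-point []      p = refl
      eval-cong-point (z ∷ h) p = +-congˡ (*-cong p (eval-cong-point h p))

    -- b is the norm of (e - z) / (- a), where z is a root of the i-th iterate.
    normalised : ∀ i → ∃[ b ] leadingCoeff i * (- a) ^ (r ℕ.^ i) * b ≈ eval (iterate f i) e ×
      (b ∈ IsPower r ⇔ orbit i ∈ IsPower r)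
    normalised zero = orbit 0 , (begin
      1# * (- a * 1#) * (- eval f γ * a⁻¹)
        ≈⟨ solve 3 (λ a u v → con (+ 1) :* (:- a :* con (+ 1)) :* (:- u :* v) := u :* (v :* a)) refl a (eval f γ) a⁻¹ ⟩
      eval f γ * (a⁻¹ * a)      ≈⟨ trans (*-congˡ a⁻¹a≈1) (*-identityʳ _) ⟩
      eval f γ                  ≈⟨ trans eval-critical (sym (eval-X e)) ⟩
      eval X e                  ∎) , mk⇔ id id
      where open import Relation.Binary.Reasoning.Setoid setoid
    -- With u = l (- a) ^ (r ^ i) for the leading coefficient l of the i-th iterate, the factor
    -- belonging to the next iterate is a u ^ r. Dividing by `a` gives `z`, and dividing by u ^ r
    -- multiplies by the r-th power of v = 1 / u.
    normalised (suc i) = z * v ^ r , def , mk⇔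
      (λ { (y , p) → y * u , trans z≈ (trans (*-congʳ p) (sym (^-distrib-* y u r))) })
      (λ { (y , p) → y * v , trans (*-congʳ p) (sym (^-distrib-* y v r)) })
      where
      open import Relation.Binary.Reasoning.Setoid setoid
      z = orbit (suc i)
      s = (- a) ^ (r ℕ.^ i)
      -a≉0 : ¬ - a ≈ 0#
      -a≉0 p = a≉0 (trans (sym (-‿involutive a)) (trans (-‿cong p) -0#≈0#))
        where open Algebra.Properties.Ring ring
      u = leadingCoeff i * s
      u≉0 : ¬ u ≈ 0#
      u≉0 = x*y≉0 (leadingCoeff≉0 i) (x^n≉0 (r ℕ.^ i) -a≉0)
      v = proj₁ (invertible u u≉0)
      v^ru^r≈1 : v ^ r * u ^ r ≈ 1#
      v^ru^r≈1 = trans (sym (^-distrib-* v u r)) (trans (^-congˡ r (proj₁ (proj₂ (invertible u u≉0)))) (1^n≈1 r))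
      z≈ : z ≈ z * v ^ r * u ^ r
      z≈ = sym (trans (*-assoc _ _ _) (trans (*-congˡ v^ru^r≈1) (*-identityʳ z)))
      def : a * leadingCoeff i ^ r * (- a) ^ (r ℕ.* r ℕ.^ i) * (z * v ^ r) ≈ eval (iterate f (suc i)) e
      def = begin
        a * leadingCoeff i ^ r * (- a) ^ (r ℕ.* r ℕ.^ i) * (z * v ^ r)
          ≈⟨ *-congʳ (*-congˡ (trans (^-congʳ (- a) (ℕ.*-comm r (r ℕ.^ i))) (sym (^-assocʳ (- a) (r ℕ.^ i) r)))) ⟩
        a * leadingCoeff i ^ r * s ^ r * (z * v ^ r)
          ≈⟨ *-congʳ (trans (*-assoc _ _ _) (*-congˡ (sym (^-distrib-* (leadingCoeff i) s r)))) ⟩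
        a * u ^ r * (z * v ^ r)
          ≈⟨ solve 4 (λ a u z v → a :* u :* (z :* v) := z :* v :* u :* a) refl a (u ^ r) z (v ^ r) ⟩
        z * v ^ r * u ^ r * a
          ≈⟨ *-congʳ z≈ ⟨
        eval (iterate f (2 ℕ.+ i)) γ * a⁻¹ * a
          ≈⟨ trans (*-assoc _ _ _) (trans (*-congˡ a⁻¹a≈1) (*-identityʳ _)) ⟩
        eval (iterate f (2 ℕ.+ i)) γ
          ≈⟨ eval-iterate (suc i) ⟨
        eval (iterate f (suc i)) e ∎

    -- For necessity the field is built from the new iterate itself: an r-th power would bound its
    -- degree r ^ (i + 1) by r ^ i, against r ≥ 2. For sufficiency the field is built from an
    -- arbitrary irreducible factor, which is forced to have full degree.
    step : ∀ i → Irreducible (iterate f i) → Irreducible (iterate f (suc i)) ⇔ (¬ orbit i ∈ IsPower r)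
    step i g-irr with normalised i
    ... | b , b-def , b⇔orbit = mk⇔ necessary sufficient
      where
      necessary : Irreducible (iterate f (suc i)) → ¬ orbit i ∈ IsPower r
      necessary p-irr power with Equivalence.from b⇔orbit power
      ... | y , b≈y^r = ℕ.<⇒≱ (≡.subst (r ℕ.^ i ℕ.<_) (ℕ.*-comm (r ℕ.^ i) r)
          (ℕ.m<m*n (r ℕ.^ i) r {{ℕ.>-nonZero (1≤r^ i)}} 2≤r))
        (Extension.power⇒degree≤ i g-irr b-def p-irr (P.1# , P.*-identityˡ _) b≈y^r (leadingCoeff≉0 (suc i))
            (iterate-leading (suc i)))
      sufficient : ¬ orbit i ∈ IsPower r → Irreducible (iterate f (suc i))
      sufficient nonpower = no-small-factor⇒irreducible (iterate f (suc i)) (1≤r^ (suc i)) (leadingCoeff≉0 (suc i))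
          (iterate-leading (suc i))
        λ {m} p p-irr p∣ s≉0 p-leading → ≡.subst (ℕ._≤ m) (ℕ.*-comm (r ℕ.^ i) r)
          (Extension.nonpower⇒≤degree i g-irr b-def p-irr p∣ (nonpower ∘ Equivalence.to b⇔orbit) s≉0 p-leading)

    all-irreducible : (∀ i → ¬ orbit i ∈ IsPower r) → ∀ i → Irreducible (iterate f i)
    all-irreducible nonpower zero    = X-irreducible
    all-irreducible nonpower (suc i) = Equivalence.from (step i (all-irreducible nonpower i)) (nonpower i)

-- Transfer between the computing and the opaque polynomial operations.

module OpaqueForm {c ℓ n} (𝕂 : FiniteField (suc n) c ℓ) where
  private
    module K = FiniteField 𝕂
    module KP = FieldPolynomials (Finite.discreteField 𝕂)
  open K using (_≈ₚ_; _+ₚ_; _*ₚ_; _^ₚ_; polyRawSemiring; 1#; sym)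
  open PolynomialRing K.commutativeRing
  open Exp (CommutativeRing.commutativeSemiring polynomialRing) using () renaming (_^_ to _^ᵖ_)

  open Algebra.Definitions.RawSemiring polyRawSemiring using () renaming (_∣_ to _∣ₚ_)
  open Algebra.Definitions.RawMagma using (_,_)
  private module P = CommutativeRing polynomialRing

  ^ₚ≡^ᵖ : ∀ f m → f ^ₚ m ≡ f ^ᵖ m
  ^ₚ≡^ᵖ f zero    = ≡.refl
  ^ₚ≡^ᵖ f (suc m) = ≡.trans (≡.sym (⊗≡*ₚ f _)) (≡.cong (f ⊗_) (^ₚ≡^ᵖ f m))

  form≡ : ∀ a g r e → const a *ₚ (X +ₚ const g) ^ₚ r +ₚ const e ≡ const a ⊗ (X ⊕ const g) ^ᵖ r ⊕ const e
  form≡ a g r e = ≡.trans (≡.sym (⊕≡+ₚ _ _)) (≡.cong (_⊕ const e) (≡.trans (≡.sym (⊗≡*ₚ _ _))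
    (≡.cong (const a ⊗_) (≡.trans (^ₚ≡^ᵖ _ r) (≡.cong (_^ᵖ r) (≡.sym (⊕≡+ₚ X (const g))))))))

  *ₚ⇒⊗ : ∀ {f} g h → f ≈ₚ g *ₚ h → f ≋ g ⊗ h
  *ₚ⇒⊗ {f} g h p = ≡.subst (f ≋_) (≡.sym (⊗≡*ₚ g h)) (coeffwise p)

  ⊗⇒*ₚ : ∀ {f} g h → f ≋ g ⊗ h → f ≈ₚ g *ₚ h
  ⊗⇒*ₚ {f} g h p = coeff-≈ (≡.subst (f ≋_) (⊗≡*ₚ g h) p)

  -- Both notions concern the same coefficient lists; only the product and the equality in each
  -- divisibility equation have to be exchanged.
  irreducible⇒ : ∀ {p} → K.Irreducible p → KP.Irreducible p
  irreducible⇒ {p} p-irr = KP.mkIrred (λ { (q , e) → p∤1 (q , λ m → sym (⊗⇒*ₚ q p (P.sym e) m)) })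
    λ {f} {g} e → ⊎.map (∣1⇒ f) (∣1⇒ g) (split-∣1 (⊗⇒*ₚ f g e))
    where
    open K.Irreducible p-irr
    ∣1⇒ : ∀ f → f ∣ₚ const 1# → f KP.∣ const 1#
    ∣1⇒ f (q , e) = q , P.sym (*ₚ⇒⊗ q f λ m → sym (e m))

  irreducible⇐ : ∀ {p} → KP.Irreducible p → K.Irreducible p
  irreducible⇐ {p} p-irr = record
    { p∤1 = λ { (q , e) → p∤1 (q , P.sym (*ₚ⇒⊗ q p λ m → sym (e m))) }
    ; split-∣1 = λ {f} {g} e → ⊎.map (∣1⇐ f) (∣1⇐ g) (split-∣1 (*ₚ⇒⊗ f g e))
    }
    where
    open KP.Irreducible p-irr
    ∣1⇐ : ∀ f → f KP.∣ const 1# → f ∣ₚ const 1#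
    ∣1⇐ f (q , e) = q , λ m → sym (⊗⇒*ₚ q f (P.sym e) m)

-- The equivalence for dynamical irreducibility.

dynamicallyIrreducible⇔ : ∀ {c ℓ} r n → Prime r → (2 ℕ.+ n) ≡ 1 [mod r ] →
  (K : FiniteField (2 ℕ.+ n) c ℓ) → let open FiniteField K in
  (f : Poly) (γ a : Carrier) (u : Unicritical f r γ a) →
  DynamicallyIrreducible f ⇔
    (∀ z → z ∈ CriticalOrbitSet f γ a (Unicritical.a≉0 u) → ¬ z ∈ IsPower r)
-- For q = 2 + n the integer q - 1 in the congruence reduces to `suc n`, so the quotient `k` is the
-- exponent (q - 1) / r used in the Kummer step.
dynamicallyIrreducible⇔ r n r-prime (divides k q-1≡kr) K f γ a u = mk⇔ necessary sufficient
  where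
  open FiniteField K
  open Unicritical u
  open OpaqueForm K
  open PolynomialRing commutativeRing using (coeffwise; _≋_)
  open Iterates K
  open Tower r-prime (≡.trans (ℕ.*-comm r k) (≡.sym q-1≡kr)) f γ (proj₁ form) a≉0
    (≡.subst (f ≋_) (form≡ a (- γ) r (proj₁ form)) (coeffwise (proj₂ form)))

  necessary : DynamicallyIrreducible f →
    ∀ z → z ∈ CriticalOrbitSet f γ a a≉0 → ¬ z ∈ IsPower r
  necessary (_ , irr) = λ
    { z (inj₁ z≈) (y , p) → nonpower 0 (y , trans (sym z≈) p)
    ; z (inj₂ (suc (suc i) , _ , z≈)) (y , p) → nonpower (suc i) (y , trans (sym z≈) p)
    ; z (inj₂ (suc zero , s≤s () , _))
    }
    where
    iterate-irreducible : ∀ i → FieldPolynomials.Irreducible (Finite.discreteField K) (iterate f i)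
    iterate-irreducible zero    = X-irreducible
    iterate-irreducible (suc i) = irreducible⇒ (irr (suc i) (s≤s z≤n))
    nonpower : ∀ i → ¬ orbit i ∈ IsPower r
    nonpower i = Equivalence.to (step i (iterate-irreducible i)) (iterate-irreducible (suc i))

  sufficient : (∀ z → z ∈ CriticalOrbitSet f γ a a≉0 → ¬ z ∈ IsPower r) → DynamicallyIrreducible f
  sufficient nonpower = (r , ℕ.nonTrivial⇒n>1 r {{prime⇒nonTrivial r-prime}} , degree) ,
    λ i _ → irreducible⇐ (all-irreducible orbit-nonpower i)
    where
    orbit-nonpower : ∀ i → ¬ orbit i ∈ IsPower r
    orbit-nonpower zero    = nonpower _ (inj₁ refl)
    orbit-nonpower (suc i) = nonpower _ (inj₂ (2 ℕ.+ i , s≤s (s≤s z≤n) , refl))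

theorem1 : ∀ {c ℓ} (r q : ℕ) → Prime r → PrimePower q → q ≡ 1 [mod r ] →
    (K : FiniteField q c ℓ) → let open FiniteField K in
    (f : Poly) (γ a : Carrier) (u : Unicritical f r γ a) →
    DynamicallyIrreducible f ⇔
    (∀ z → z ∈ CriticalOrbitSet f γ a (Unicritical.a≉0 u) → ¬ z ∈ IsPower r)
-- A field contains `0#`, and `1#` differs from it, which rules out the sizes 0 and 1.
theorem1 r zero _ _ _ K = contradiction (Inverse.to (FiniteField.enumeration K) (FiniteField.0# K)) λ ()
theorem1 r (suc zero) _ _ _ K = contradiction (Finite.index-injective K (Fin1-unique _ _)) (FiniteField.1≉0 K)
  where
  Fin1-unique : (i j : Fin 1) → i ≡ j
  Fin1-unique zero zero = ≡.refl
theorem1 r (suc (suc n)) r-prime _ q≡1 K = dynamicallyIrreducible⇔ r n r-prime q≡1 K
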